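{- Let $k$ be a fixed positive integer. There exists a constant $n_0(k)$ such that the following holds. If $n\geq n_0(k)$, $t$ is an integer, and $S\subseteq \mathcal{P}(n)$ has cardinality at least \[\sum_{r=0}^{k-1}\binom{n}{\left\lceil \frac{n-k+1 +2r}{2}\right\rceil} + t,\] then \[\mathrm{comp}(S)\geq t\binom{\left\lceil (n+k)/2\right\rceil}{k}.\]
   Context: $\mathcal{P}(n)$ is the boolean lattice: the set of all subsets of $[n]=\{1,\dots,n\}$ ordered by inclusion. For $S\subseteq \mathcal{P}(n)$, $\mathrm{comp}(S)$ is the number of unordered pairs of distinct comparable elements of $S$. -}

module Defs where

open import Data.Fin.Subset using (Subset; _⊆_)
open import Data.Fin.Subset.Properties using (_⊆?_)
open import Data.List using (List; []; _∷_; _++_; length; filter; map; upTo)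
open import Data.Nat using (ℕ; suc; _+_; _*_; _∸_; ⌈_/2⌉)
open import Data.Nat.Combinatorics using (_C_)
open import Data.Nat.ListAction using (sum)
open import Data.Product using (_×_; _,_)
open import Data.Sum using (_⊎_)
open import Level using (0ℓ)
open import Relation.Nullary.Decidable using (_⊎-dec_)
open import Relation.Unary using (Pred; Decidable)

-- Each unordered pair of positions in the list occurs exactly once.  For a
-- duplicate-free list these are the unordered pairs of distinct elements.
pairs : ∀ {a} {A : Set a} → List A → List (A × A)
pairs []       = []
pairs (x ∷ xs) = map (x ,_) xs ++ pairs xs

Comparable : ∀ {n} → Pred (Subset n × Subset n) 0ℓ
Comparable (A , B) = A ⊆ B ⊎ B ⊆ A

comparable? : ∀ {n} → Decidable (Comparable {n})
comparable? (A , B) = (A ⊆? B) ⊎-dec (B ⊆? A)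

-- A family S ⊆ P(n) is given by a duplicate-free list of its members, so that
-- |S| is the length of the list; comp is only meaningful on such lists.
comp : ∀ {n} → List (Subset n) → ℕ
comp S = length (filter comparable? (pairs S))

-- The sum over 0 ≤ r ≤ k - 1 of C(n, ⌈(n - k + 1 + 2r)/2⌉).  The truncated
-- subtraction is exact once k ≤ n + 1; smaller n do not matter for a statement
-- about all sufficiently large n.
middleLayers : ℕ → ℕ → ℕ
middleLayers n k = sum (map (λ r → n C ⌈ (suc n ∸ k) + 2 * r /2⌉) (upTo k))

{-# OPTIONS --safe #-}

-- Average over all maximal chains F of P(n), weighting a set of size j on F by
-- C(n, j): every set then contributes 1 to |S|.  On a single chain the weights of
-- S ∩ F add up to at most those of the k middle layers plus the sum of
-- min (C(n, a), C(n, b)) over the pairs of levels a, b of S ∩ F at distance at least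
-- k: while more than k levels are present, the outermost one has the least weight and
-- is paid for by a level at distance at least k.  After averaging, a pair A ⊂ B costs
-- 1 / C(max (b, n - a), b - a), which is at most 1 / C(⌈(n + k)/2⌉, k) unless a < k
-- (and b > n - k).  If S has a set A with |A| < k, then either A is comparable to
-- C(⌈(n + k)/2⌉, k) other members and can be deleted by induction on t, or most chains
-- through A avoid S on the two most central levels.  Each such chain has an
-- exponentially large slack, while the exceptional pairs cost only a polynomial.

module Submission where

open import Defs
open import Data.Nat using (ℕ; NonZero; _≥_; ⌈_/2⌉)
open import Data.Nat.Combinatorics using (_C_)
open import Data.Integer using (ℤ)
open import Data.List using (List; length)
open import Data.List.Relation.Unary.Unique.Propositional using (Unique)
open import Data.Fin.Subset using (Subset)
open import Data.Product using (∃-syntax)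
import Data.Nat as ℕ
import Data.Integer as ℤ

import Data.Integer.Properties as ℤ
open import Data.Empty using (⊥-elim)
open import Data.Fin.Subset using (Side; inside; outside; ∣_∣; _⊆_)
open import Data.Fin.Subset.Properties
  using (drop-∷-⊆; out⊆; in⊆in; ⊆-refl; ⊆-antisym; p⊆q⇒∣p∣≤∣q∣; ∣p∣≤n)
open import Data.List using ([]; _∷_; _++_; filter; map; upTo; cartesianProductWith)
open import Data.List.Membership.Propositional using (_∈_; find)
open import Data.List.Membership.Propositional.Properties using (∈-∃++)
open import Data.List.Properties
  using (upTo-∷ʳ; length-upTo; length-map; map-∘; map-cong; map-upTo; map-applyUpTo)
open import Data.List.Relation.Binary.Permutation.Propositional
  using (_↭_; ↭-refl; ↭-trans; prep)
import Data.List.Relation.Binary.Permutation.Propositional as Perm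
open import Data.List.Relation.Binary.Permutation.Propositional.Properties
  using (All-resp-↭; map⁺; shift; ↭-length)
import Data.List.Relation.Binary.Permutation.Setoid.Properties as PermSetoid
open import Data.List.Relation.Unary.All as All using (All; []; _∷_)
import Data.List.Relation.Unary.All.Properties as All
open import Data.List.Relation.Unary.All.Properties using (all-filter)
open import Data.List.Relation.Unary.AllPairs as AllPairs using (AllPairs; []; _∷_)
import Data.List.Relation.Unary.AllPairs.Properties as AllPairs
open import Data.List.Relation.Unary.Any as Any using (Any; here; there)
import Data.List.Relation.Unary.Unique.Propositional.Properties as Unique
open import Data.Nat
  using (zero; suc; _+_; _*_; _∸_; _^_; _!; _≤_; _<_; _>_; _⊓_; z≤n; s≤s; s≤s⁻¹;
         ∣_-_∣; ⌊_/2⌋; _≤?_; _<?_; >-nonZero; ≢-nonZero⁻¹)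
open import Data.Nat.Combinatorics
  using (nCk≡n!/k![n-k]!; nCk≡nC[n∸k]; nCk+nC[k+1]≡[n+1]C[k+1]; k![n∸k]!∣n!)
open import Data.Nat.DivMod
  using (_/_; _%_; m/n*n≡m; m≡m%n+[m/n]*n; m%n<n; /-monoˡ-≤; m*n/n≡m; m/n*n≤m)
open import Data.Nat.ListAction using (sum)
open import Data.Nat.ListAction.Properties using (sum-↭)
open import Data.Nat.Properties hiding (_≤?_; _<?_)
open import Data.Nat.Tactic.RingSolver using (solve-∀)
open import Data.Product using (∃; _×_; _,_; proj₁; proj₂; uncurry)
open import Data.Sum as Sum using (_⊎_; inj₁; inj₂)
open import Data.Unit using (⊤; tt)
open import Data.Vec using (Vec; []; _∷_; here)
open import Function using (_∘_; id)
open import Relation.Binary.Definitions using (tri<; tri≈; tri>)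
open import Relation.Binary.PropositionalEquality
open import Relation.Nullary using (¬_; Dec; yes; no; contradiction)
open import Relation.Nullary.Decidable using (_×-dec_)
open import Relation.Unary using (Pred; Decidable)

-- Averages appear as sums over `flags n`, scaled by `n !` so that no fraction occurs: a set of size
-- j lies on j! (n - j)! chains, and the weight C(n, j) turns this into `n !`. Small sets are the
-- obstacle. The pair of the empty and the full set lies on every chain and has weight 1, so it
-- costs a whole unit, far more than 1 / C(⌈(n + k)/2⌉, k). Since a pair has to fail at both ends to
-- be exceptional, it is enough to treat its lower set; the dual case of sets larger than n - k
-- never has to be considered. Deletion lowers |S| and t by one together, so the hypothesis on |S|
-- survives. In the other alternative no further induction takes place: the slack of the chains
-- through a single low set pays for the exceptional pairs on all chains at once, because these
-- chains still form at least a polynomial fraction of all `n !`.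

private
  variable
    A B : Set

-- Finite sums

∑ : List A → (A → ℕ) → ℕ
∑ xs f = sum (map f xs)

∑-cong : ∀ (xs : List A) {f g : A → ℕ} → (∀ x → f x ≡ g x) → ∑ xs f ≡ ∑ xs g
∑-cong xs f≗g = cong sum (map-cong f≗g xs)

∑-mono-∈ : ∀ (xs : List A) {f g : A → ℕ} → (∀ {x} → x ∈ xs → f x ≤ g x) → ∑ xs f ≤ ∑ xs g
∑-mono-∈ []       f≤g = z≤n
∑-mono-∈ (x ∷ xs) f≤g = +-mono-≤ (f≤g (here refl)) (∑-mono-∈ xs (f≤g ∘ there))

∑-mono : ∀ (xs : List A) {f g : A → ℕ} → (∀ x → f x ≤ g x) → ∑ xs f ≤ ∑ xs g
∑-mono xs f≤g = ∑-mono-∈ xs λ {x} _ → f≤g x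

∑-+ : ∀ (xs : List A) (f g : A → ℕ) → ∑ xs (λ x → f x + g x) ≡ ∑ xs f + ∑ xs g
∑-+ []       f g = refl
∑-+ (x ∷ xs) f g = trans (cong ((f x + g x) +_) (∑-+ xs f g)) (+-interchange (f x) (g x) _ _)
  where
  +-interchange : ∀ a b c d → (a + b) + (c + d) ≡ (a + c) + (b + d)
  +-interchange = solve-∀

∑-*ˡ : ∀ (xs : List A) (f : A → ℕ) a → ∑ xs (λ x → a * f x) ≡ a * ∑ xs f
∑-*ˡ []       f a = sym (*-zeroʳ a)
∑-*ˡ (x ∷ xs) f a = trans (cong (a * f x +_) (∑-*ˡ xs f a)) (sym (*-distribˡ-+ a (f x) _))

∑-*ʳ : ∀ (xs : List A) (f : A → ℕ) a → ∑ xs (λ x → f x * a) ≡ ∑ xs f * a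
∑-*ʳ xs f a = trans (∑-cong xs λ x → *-comm (f x) a) (trans (∑-*ˡ xs f a) (*-comm a _))

∑-const : ∀ (xs : List A) a → ∑ xs (λ _ → a) ≡ length xs * a
∑-const []       a = refl
∑-const (x ∷ xs) a = cong (a +_) (∑-const xs a)

∑-0 : ∀ (xs : List A) → ∑ xs (λ _ → 0) ≡ 0
∑-0 xs = trans (∑-const xs 0) (*-zeroʳ (length xs))

∑-swap : ∀ (xs : List A) (ys : List B) (f : A → B → ℕ) →
         ∑ xs (λ x → ∑ ys (f x)) ≡ ∑ ys (λ y → ∑ xs (λ x → f x y))
∑-swap []       ys f = sym (∑-0 ys)
∑-swap (x ∷ xs) ys f = trans (cong (∑ ys (f x) +_) (∑-swap xs ys f)) (sym (∑-+ ys (f x) _))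

∑-++ : ∀ (xs ys : List A) (f : A → ℕ) → ∑ (xs ++ ys) f ≡ ∑ xs f + ∑ ys f
∑-++ []       ys f = refl
∑-++ (x ∷ xs) ys f = trans (cong (f x +_) (∑-++ xs ys f)) (sym (+-assoc (f x) _ _))

∑-map : ∀ (xs : List A) (g : A → B) (f : B → ℕ) → ∑ (map g xs) f ≡ ∑ xs (f ∘ g)
∑-map xs g f = cong sum (sym (map-∘ xs))

∑-↭ : ∀ {xs ys : List A} (f : A → ℕ) → xs ↭ ys → ∑ xs f ≡ ∑ ys f
∑-↭ f p = sum-↭ (map⁺ f p)

∑-upTo-suc : ∀ k (f : ℕ → ℕ) → ∑ (upTo (suc k)) f ≡ f 0 + ∑ (upTo k) (f ∘ suc)
∑-upTo-suc k f = cong (λ xs → f 0 + sum xs)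
  (trans (map-applyUpTo suc f k) (sym (map-upTo (f ∘ suc) k)))

∑-upTo-last : ∀ k (f : ℕ → ℕ) → ∑ (upTo (suc k)) f ≡ ∑ (upTo k) f + f k
∑-upTo-last k f = begin
  ∑ (upTo (suc k)) f         ≡⟨ cong (λ xs → ∑ xs f) (upTo-∷ʳ k) ⟨
  ∑ (upTo k ++ k ∷ []) f     ≡⟨ ∑-++ (upTo k) (k ∷ []) f ⟩
  ∑ (upTo k) f + (f k + 0)   ≡⟨ cong (∑ (upTo k) f +_) (+-identityʳ (f k)) ⟩
  ∑ (upTo k) f + f k         ∎
  where open ≡-Reasoning

∑-cartesianProductWith : ∀ {C : Set} (g : A → B → C) xs ys (f : C → ℕ) →
  ∑ (cartesianProductWith g xs ys) f ≡ ∑ xs (λ x → ∑ ys (λ y → f (g x y)))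
∑-cartesianProductWith g []       ys f = refl
∑-cartesianProductWith g (x ∷ xs) ys f = trans (∑-++ (map (g x) ys) _ f)
  (cong₂ _+_ (∑-map ys (g x) f) (∑-cartesianProductWith g xs ys f))

-- Sums over unordered pairs

∑₂ : List A → (A → A → ℕ) → ℕ
∑₂ xs f = ∑ (pairs xs) (uncurry f)

∑₂-∷ : ∀ x (xs : List A) f → ∑₂ (x ∷ xs) f ≡ ∑ xs (f x) + ∑₂ xs f
∑₂-∷ x xs f = trans (∑-++ (map (x ,_) xs) (pairs xs) _) (cong (_+ ∑₂ xs f) (∑-map xs (x ,_) _))

∑₂-mono-∈ : ∀ (xs : List A) {f g : A → A → ℕ} →
            (∀ {x y} → x ∈ xs → y ∈ xs → f x y ≤ g x y) → ∑₂ xs f ≤ ∑₂ xs g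
∑₂-mono-∈ []       f≤g = z≤n
∑₂-mono-∈ (x ∷ xs) {f} {g} f≤g = subst₂ _≤_ (sym (∑₂-∷ x xs f)) (sym (∑₂-∷ x xs g))
  (+-mono-≤ (∑-mono-∈ xs λ y∈ → f≤g (here refl) (there y∈))
            (∑₂-mono-∈ xs λ x∈ y∈ → f≤g (there x∈) (there y∈)))

∑₂-map : ∀ (xs : List A) (g : A → B) (f : B → B → ℕ) →
         ∑₂ (map g xs) f ≡ ∑₂ xs (λ x y → f (g x) (g y))
∑₂-map []       g f = refl
∑₂-map (x ∷ xs) g f = begin
  ∑₂ (map g (x ∷ xs)) f                                        ≡⟨ ∑₂-∷ (g x) (map g xs) f ⟩
  ∑ (map g xs) (f (g x)) + ∑₂ (map g xs) f                     ≡⟨ cong₂ _+_ (∑-map xs g _) (∑₂-map xs g f) ⟩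
  ∑ xs (f (g x) ∘ g) + ∑₂ xs (λ x y → f (g x) (g y))           ≡⟨ ∑₂-∷ x xs _ ⟨
  ∑₂ (x ∷ xs) (λ x y → f (g x) (g y))                          ∎
  where open ≡-Reasoning

-- `pairs` orients each pair by position in the list, and a permutation may reverse it; hence the
-- symmetry of `f`.
∑₂-↭ : ∀ {xs ys : List A} (f : A → A → ℕ) → (∀ x y → f x y ≡ f y x) → xs ↭ ys → ∑₂ xs f ≡ ∑₂ ys f
∑₂-↭ f f-sym Perm.refl = refl
∑₂-↭ f f-sym (prep {xs} {ys} x p) =
  trans (∑₂-∷ x xs f) (trans (cong₂ _+_ (∑-↭ (f x) p) (∑₂-↭ f f-sym p)) (sym (∑₂-∷ x ys f)))
∑₂-↭ f f-sym (Perm.swap {xs} {ys} x y p) = begin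
  ∑₂ (x ∷ y ∷ xs) f                                 ≡⟨ expand x y xs ⟩
  (f x y + ∑ xs (f x)) + (∑ xs (f y) + ∑₂ xs f)     ≡⟨ cong₂ _+_ (cong₂ _+_ (f-sym x y) (∑-↭ (f x) p))
                                                        (cong₂ _+_ (∑-↭ (f y) p) (∑₂-↭ f f-sym p)) ⟩
  (f y x + ∑ ys (f x)) + (∑ ys (f y) + ∑₂ ys f)     ≡⟨ exchange (f y x) _ _ _ ⟩
  (f y x + ∑ ys (f y)) + (∑ ys (f x) + ∑₂ ys f)     ≡⟨ expand y x ys ⟨
  ∑₂ (y ∷ x ∷ ys) f                                 ∎
  where
  open ≡-Reasoning
  expand : ∀ x y zs → ∑₂ (x ∷ y ∷ zs) f ≡ (f x y + ∑ zs (f x)) + (∑ zs (f y) + ∑₂ zs f)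
  expand x y zs = trans (∑₂-∷ x (y ∷ zs) f) (cong ((f x y + ∑ zs (f x)) +_) (∑₂-∷ y zs f))
  exchange : ∀ a b c d → (a + b) + (c + d) ≡ (a + c) + (b + d)
  exchange = solve-∀
∑₂-↭ f f-sym (Perm.trans p q) = trans (∑₂-↭ f f-sym p) (∑₂-↭ f f-sym q)

length-pairs : ∀ (xs : List A) → length (pairs xs) ≤ length xs * length xs
length-pairs xs = subst (_≤ length xs * length xs) (trans (∑-const (pairs xs) 1) (*-identityʳ _)) (go xs)
  where
  go : ∀ (ys : List A) → ∑₂ ys (λ _ _ → 1) ≤ length ys * length ys
  go []       = z≤n
  go (y ∷ ys) = begin
    ∑₂ (y ∷ ys) (λ _ _ → 1)                  ≡⟨ ∑₂-∷ y ys (λ _ _ → 1) ⟩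
    ∑ ys (λ _ → 1) + ∑₂ ys (λ _ _ → 1)       ≤⟨ +-mono-≤ (≤-reflexive (trans (∑-const ys 1) (*-identityʳ _))) (go ys) ⟩
    l + l * l                                ≤⟨ m≤n+m _ (suc l) ⟩
    suc l + (l + l * l)                      ≡⟨ cong (suc l +_) (*-suc l l) ⟨
    suc l * suc l                            ∎
    where
    open ≤-Reasoning
    l = length ys

-- Indicators and filtered sums

𝟙 : ∀ {p} {P : Set p} → Dec P → ℕ
𝟙 (yes _) = 1
𝟙 (no  _) = 0

𝟙≤1 : ∀ {p} {P : Set p} (P? : Dec P) → 𝟙 P? ≤ 1
𝟙≤1 (yes _) = ≤-refl
𝟙≤1 (no  _) = z≤n

𝟙-yes : ∀ {p} {P : Set p} (P? : Dec P) → P → 𝟙 P? ≡ 1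
𝟙-yes (yes _) _ = refl
𝟙-yes (no ¬p) p = contradiction p ¬p

𝟙-no : ∀ {p} {P : Set p} (P? : Dec P) → ¬ P → 𝟙 P? ≡ 0
𝟙-no (yes p) ¬p = contradiction p ¬p
𝟙-no (no _)  _  = refl

𝟙-× : ∀ {p q} {P : Set p} {Q : Set q} (P? : Dec P) (Q? : Dec Q) → 𝟙 (P? ×-dec Q?) ≡ 𝟙 P? * 𝟙 Q?
𝟙-× (yes _) (yes _) = refl
𝟙-× (yes _) (no  _) = refl
𝟙-× (no  _) (yes _) = refl
𝟙-× (no  _) (no  _) = refl

𝟙-⇔ : ∀ {p q} {P : Set p} {Q : Set q} (P? : Dec P) (Q? : Dec Q) → (P → Q) → (Q → P) → 𝟙 P? ≡ 𝟙 Q?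
𝟙-⇔ (yes p) Q? to from = sym (𝟙-yes Q? (to p))
𝟙-⇔ (no ¬p) Q? to from = sym (𝟙-no Q? (¬p ∘ from))

length-filter≡∑ : ∀ {p} {P : Pred A p} (P? : Decidable P) xs → length (filter P? xs) ≡ ∑ xs (𝟙 ∘ P?)
length-filter≡∑ P? [] = refl
length-filter≡∑ P? (x ∷ xs) with P? x
... | yes _ = cong suc (length-filter≡∑ P? xs)
... | no  _ = length-filter≡∑ P? xs

∑-filter : ∀ {p} {P : Pred A p} (P? : Decidable P) xs (f : A → ℕ) →
           ∑ (filter P? xs) f ≡ ∑ xs (λ x → 𝟙 (P? x) * f x)
∑-filter P? [] f = refl
∑-filter P? (x ∷ xs) f with P? x
... | yes _ = cong₂ _+_ (sym (+-identityʳ (f x))) (∑-filter P? xs f)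
... | no  _ = ∑-filter P? xs f

∑₂-filter : ∀ {p} {P : Pred A p} (P? : Decidable P) xs (f : A → A → ℕ) →
            ∑₂ (filter P? xs) f ≡ ∑₂ xs (λ x y → (𝟙 (P? x) * 𝟙 (P? y)) * f x y)
∑₂-filter P? [] f = refl
∑₂-filter {A = A} P? (x ∷ xs) f = trans step (sym (∑₂-∷ x xs _))
  where
  g : A → A → ℕ
  g y z = (𝟙 (P? y) * 𝟙 (P? z)) * f y z
  step : ∑₂ (filter P? (x ∷ xs)) f ≡ ∑ xs (g x) + ∑₂ xs g
  step with P? x
  ... | yes _ = trans (∑₂-∷ x (filter P? xs) f) (cong₂ _+_
        (trans (∑-filter P? xs (f x)) (∑-cong xs λ y → cong (_* f x y) (sym (+-identityʳ (𝟙 (P? y))))))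
        (∑₂-filter P? xs f))
  ... | no  _ = trans (∑₂-filter P? xs f) (cong (_+ ∑₂ xs g) (sym (∑-0 xs)))

-- Sorting lists with distinct keys

sort-by : ∀ (key : A → ℕ) xs → AllPairs (λ x y → key x ≢ key y) xs →
          ∃ λ ys → xs ↭ ys × AllPairs (λ x y → key x > key y) ys
sort-by {A} key []       []        = [] , ↭-refl , []
sort-by {A} key (x ∷ xs) (x# ∷ u) with sort-by key xs u
... | ys , xs↭ys , sorted with insert ys sorted (All-resp-↭ xs↭ys x#)
  where
  insert : ∀ ys → AllPairs (λ x y → key x > key y) ys → All (λ y → key x ≢ key y) ys →
           ∃ λ zs → x ∷ ys ↭ zs × AllPairs (λ x y → key x > key y) zs
  insert [] _ _ = x ∷ [] , ↭-refl , [] ∷ []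
  insert (y ∷ ys) (y> ∷ sorted) (x≢y ∷ x#) with <-cmp (key x) (key y)
  ... | tri> _ _ x>y = x ∷ y ∷ ys , ↭-refl , (x>y ∷ All.map (λ z<y → <-trans z<y x>y) y>) ∷ y> ∷ sorted
  ... | tri≈ _ x≡y _ = contradiction x≡y x≢y
  ... | tri< x<y _ _ with insert ys sorted x#
  ...   | zs , p , sorted′ = y ∷ zs , ↭-trans (Perm.swap x y ↭-refl) (prep y p) ,
                             All-resp-↭ p (x<y ∷ y>) ∷ sorted′
... | zs , p , sorted′ = zs , ↭-trans (prep x xs↭ys) p , sorted′

decreasing⇒m+length≤head : ∀ {m x xs} → AllPairs _>_ (x ∷ xs) → All (m ≤_) (x ∷ xs) → m + length xs ≤ x
decreasing⇒m+length≤head {m} {x} {[]}     _ (m≤x ∷ _) = subst (_≤ x) (sym (+-identityʳ m)) m≤x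
decreasing⇒m+length≤head {m} {x} {y ∷ ys} ((y<x ∷ _) ∷ dec) (_ ∷ m≤) = begin
  m + suc (length ys)  ≡⟨ +-suc m (length ys) ⟩
  suc (m + length ys)  ≤⟨ s≤s (decreasing⇒m+length≤head dec m≤) ⟩
  suc y                ≤⟨ y<x ⟩
  x                    ∎
  where open ≤-Reasoning

unique-interval⇒length≤ : ∀ {m l} {xs : List ℕ} → Unique xs → All (m ≤_) xs → All (_< m + l) xs → length xs ≤ l
unique-interval⇒length≤ {m} {l} {xs} u m≤ <m+l with sort-by id xs u
... | []     , p , _   = subst (_≤ l) (sym (↭-length p)) z≤n
... | y ∷ ys , p , dec = subst (_≤ l) (sym (↭-length p)) (+-cancelˡ-< m (length ys) l
        (<-≤-trans (s≤s (decreasing⇒m+length≤head dec (All-resp-↭ p m≤))) (All.head (All-resp-↭ p <m+l))))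

-- An entry followed by i others is at least `m + i`, because the list decreases strictly and stays
-- above `m`. So its value is at most `f (m + i)`.
∑-decreasing≤ : ∀ {f : ℕ → ℕ} → (∀ {i j} → i ≤ j → f j ≤ f i) →
                ∀ {m k} xs → AllPairs _>_ xs → All (m ≤_) xs → length xs ≤ k →
                ∑ xs f ≤ ∑ (upTo k) (λ i → f (m + i))
∑-decreasing≤ anti []       _           _         _             = z≤n
∑-decreasing≤ {f} anti {m} {suc k} (x ∷ xs) (x> ∷ dec) m≤@(_ ∷ m≤′) (s≤s len≤k) = begin
  f x + ∑ xs f                                                ≤⟨ +-mono-≤ (anti (decreasing⇒m+length≤head (x> ∷ dec) m≤))
                                                                   (∑-decreasing≤ anti xs dec m≤′ ≤-refl) ⟩
  f (m + length xs) + ∑ (upTo (length xs)) (λ i → f (m + i))  ≡⟨ +-comm (f (m + length xs)) _ ⟩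
  ∑ (upTo (length xs)) (λ i → f (m + i)) + f (m + length xs)  ≡⟨ ∑-upTo-last (length xs) _ ⟨
  ∑ (upTo (suc (length xs))) (λ i → f (m + i))                ≤⟨ ∑-upTo-mono (s≤s len≤k) ⟩
  ∑ (upTo (suc k)) (λ i → f (m + i))                          ∎
  where
  open ≤-Reasoning
  ∑-upTo-mono : ∀ {g : ℕ → ℕ} {i j} → i ≤ j → ∑ (upTo i) g ≤ ∑ (upTo j) g
  ∑-upTo-mono z≤n = z≤n
  ∑-upTo-mono {g} (s≤s {i} {j} i≤j) = subst₂ _≤_ (sym (∑-upTo-suc i g)) (sym (∑-upTo-suc j g))
    (+-monoʳ-≤ (g 0) (∑-upTo-mono i≤j))

-- Binomial coefficients

C-factorial : ∀ i j → ((i + j) C i) * (i ! * j !) ≡ (i + j) !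
C-factorial i j = begin
  ((i + j) C i) * (i ! * j !)                             ≡⟨ cong (λ z → ((i + j) C i) * (i ! * z !)) (m+n∸m≡n i j) ⟨
  ((i + j) C i) * (i ! * (i + j ∸ i) !)                   ≡⟨ cong (_* (i ! * (i + j ∸ i) !)) (nCk≡n!/k![n-k]! i≤i+j) ⟩
  (i + j) ! / (i ! * (i + j ∸ i) !) * (i ! * (i + j ∸ i) !) ≡⟨ m/n*n≡m (k![n∸k]!∣n! i≤i+j) ⟩
  (i + j) !                                               ∎
  where
  open ≡-Reasoning
  i≤i+j = m≤m+n i j
  instance _ = i !* (i + j ∸ i) !≢0

C-sym : ∀ i j → (i + j) C i ≡ (i + j) C j
C-sym i j = trans (nCk≡nC[n∸k] (m≤m+n i j)) (cong ((i + j) C_) (m+n∸m≡n i j))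

C-absorb : ∀ i j → suc i * ((i + suc j) C suc i) ≡ suc j * ((i + suc j) C i)
C-absorb i j = *-cancelʳ-≡ _ _ (i ! * j !) (begin
  suc i * c₁ * (i ! * j !)                 ≡⟨ regroup₁ (suc i) c₁ (i !) (j !) ⟩
  c₁ * (suc i ! * j !)                     ≡⟨ cong (λ n → (n C suc i) * (suc i ! * j !)) (+-suc i j) ⟩
  ((suc i + j) C suc i) * (suc i ! * j !)  ≡⟨ C-factorial (suc i) j ⟩
  (suc i + j) !                            ≡⟨ cong _! (+-suc i j) ⟨
  (i + suc j) !                            ≡⟨ C-factorial i (suc j) ⟨
  c₀ * (i ! * suc j !)                     ≡⟨ regroup₂ (suc j) c₀ (i !) (j !) ⟨
  suc j * c₀ * (i ! * j !)                 ∎)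
  where
  open ≡-Reasoning
  c₁ = (i + suc j) C suc i
  c₀ = (i + suc j) C i
  instance _ = i !* j !≢0
  regroup₁ : ∀ s c a b → s * c * (a * b) ≡ c * (s * a * b)
  regroup₁ = solve-∀
  regroup₂ : ∀ s c a b → s * c * (a * b) ≡ c * (a * (s * b))
  regroup₂ = solve-∀

-- By `C-absorb`, the step from level j to j + 1 multiplies the binomial by (n - j) / (j + 1), which
-- is at least 1 up to the middle.
C-mono-below-middle : ∀ {n i j} → i ≤ j → j + j ≤ n → n C i ≤ n C j
C-mono-below-middle i≤j = go (≤⇒≤′ i≤j)
  where
  open ≤-Reasoning
  go : ∀ {n i j} → i ℕ.≤′ j → j + j ≤ n → n C i ≤ n C j
  go ℕ.≤′-refl _ = ≤-refl
  go {n} {i} {suc j} (ℕ.≤′-step i≤′j) 2j≤n with m≤n⇒∃[o]m+o≡n 2j≤n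
  ... | d , refl = ≤-trans (go i≤′j (≤-trans (+-mono-≤ (n≤1+n j) (n≤1+n j)) (m≤m+n _ d)))
                           (subst (λ n → n C j ≤ n C suc j) (sym (split j d)) step)
    where
    split : ∀ j d → suc j + suc j + d ≡ j + suc (suc (j + d))
    split = solve-∀
    m = j + suc (suc (j + d))
    step : m C j ≤ m C suc j
    step = *-cancelˡ-≤ (suc j) (begin
      suc j * (m C j)                ≤⟨ *-monoˡ-≤ (m C j) (s≤s (≤-trans (m≤m+n j d) (n≤1+n _))) ⟩
      suc (suc (j + d)) * (m C j)    ≡⟨ C-absorb j (suc (j + d)) ⟨
      suc j * (m C suc j)            ∎)

C-monoˡ : ∀ k {m n} → m ≤ n → m C k ≤ n C k
C-monoˡ k m≤n = go k (≤⇒≤′ m≤n)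
  where
  go : ∀ k {m n} → m ℕ.≤′ n → m C k ≤ n C k
  go k       ℕ.≤′-refl = ≤-refl
  go zero    (ℕ.≤′-step m≤′n) = ≤-refl
  go (suc k) {m} {suc n} (ℕ.≤′-step m≤′n) =
    ≤-trans (go (suc k) m≤′n) (subst (n C suc k ≤_) (nCk+nC[k+1]≡[n+1]C[k+1] n k) (m≤n+m _ (n C k)))

-- By symmetry the right side is the binomial at the smaller of `i` and `d`, and `k` lies below it
-- on the increasing half.
C≤C-between : ∀ {k i d} → k ≤ i → k ≤ d → (i + d) C k ≤ (i + d) C i
C≤C-between {k} {i} {d} k≤i k≤d with ≤-total i d
... | inj₁ i≤d = C-mono-below-middle k≤i (+-monoʳ-≤ i i≤d)
... | inj₂ d≤i = subst ((i + d) C k ≤_) (sym (C-sym i d)) (C-mono-below-middle k≤d (+-monoˡ-≤ d d≤i))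

C≤[1+n]^k : ∀ n k → n C k ≤ suc n ^ k
C≤[1+n]^k n       zero    = ≤-refl
C≤[1+n]^k zero    (suc k) = z≤n
C≤[1+n]^k (suc n) (suc k) = begin
  suc n C suc k                 ≡⟨ nCk+nC[k+1]≡[n+1]C[k+1] n k ⟨
  n C k + n C suc k             ≤⟨ +-mono-≤ (C≤[1+n]^k n k) (C≤[1+n]^k n (suc k)) ⟩
  suc n ^ k + suc n * suc n ^ k ≡⟨⟩
  suc (suc n) * suc n ^ k       ≤⟨ *-monoʳ-≤ (suc (suc n)) (^-monoˡ-≤ k (n≤1+n (suc n))) ⟩
  suc (suc n) ^ suc k           ∎
  where open ≤-Reasoning

-- Both summands of Pascal's rule satisfy the hypotheses for q - 1, so the bound doubles. For q = 0
-- only positivity is claimed, which holds as a factorial is not zero.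
2^q≤C : ∀ {q i j} → q ≤ i → q ≤ j → 2 ^ q ≤ (i + j) C i
2^q≤C {zero} {i} {j} _ _ = n≢0⇒n>0 λ C≡0 →
  ≢-nonZero⁻¹ ((i + j) !) {{(i + j) !≢0}} (trans (sym (C-factorial i j)) (cong (_* (i ! * j !)) C≡0))
2^q≤C {suc q} {suc i} {suc j} (s≤s q≤i) (s≤s q≤j) = begin
  2 * 2 ^ q                               ≡⟨ cong (2 ^ q +_) (+-identityʳ (2 ^ q)) ⟩
  2 ^ q + 2 ^ q                           ≤⟨ +-mono-≤ (2^q≤C q≤i (m≤n⇒m≤1+n q≤j)) (2^q≤C (m≤n⇒m≤1+n q≤i) q≤j) ⟩
  (i + suc j) C i + (suc i + j) C suc i   ≡⟨ cong (λ m → (i + suc j) C i + m C suc i) (+-suc i j) ⟨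
  (i + suc j) C i + (i + suc j) C suc i   ≡⟨ nCk+nC[k+1]≡[n+1]C[k+1] (i + suc j) i ⟩
  suc (i + suc j) C suc i                 ∎
  where open ≤-Reasoning

-- Chain counts against the binomial of the theorem

C-trinomial : ∀ i d e → ((i + d + e) C (i + d)) * ((i + d) C i) * (i ! * d ! * e !) ≡ (i + d + e) !
C-trinomial i d e = begin
  C₁ * C₂ * (i ! * d ! * e !)   ≡⟨ regroup C₁ C₂ (i !) (d !) (e !) ⟩
  C₁ * (C₂ * (i ! * d !) * e !) ≡⟨ cong (λ z → C₁ * (z * e !)) (C-factorial i d) ⟩
  C₁ * ((i + d) ! * e !)        ≡⟨ C-factorial (i + d) e ⟩
  (i + d + e) !                 ∎
  where
  open ≡-Reasoning
  C₁ = (i + d + e) C (i + d)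
  C₂ = (i + d) C i
  regroup : ∀ p q a b c → p * q * (a * b * c) ≡ p * (q * (a * b) * c)
  regroup = solve-∀

⌊m+2n/2⌋ : ∀ m n → ⌊ m + 2 * n /2⌋ ≡ ⌊ m /2⌋ + n
⌊m+2n/2⌋ m zero    = trans (cong ⌊_/2⌋ (+-identityʳ m)) (sym (+-identityʳ _))
⌊m+2n/2⌋ m (suc n) = begin
  ⌊ m + 2 * suc n /2⌋         ≡⟨ cong ⌊_/2⌋ (shuffle m n) ⟩
  suc ⌊ m + 2 * n /2⌋         ≡⟨ cong suc (⌊m+2n/2⌋ m n) ⟩
  suc (⌊ m /2⌋ + n)           ≡⟨ +-suc _ n ⟨
  ⌊ m /2⌋ + suc n             ∎
  where
  open ≡-Reasoning
  shuffle : ∀ m n → m + 2 * suc n ≡ suc (suc (m + 2 * n))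
  shuffle = solve-∀

-- For a set in the first layer beyond the k middle ones, this is the number of comparable sets k
-- levels away, on the opposite edge of the middle layers.
extra : ℕ → ℕ → ℕ
extra n k = ⌈ n + k /2⌉ C k

-- Here `i`, `d`, `e` are |A|, |B| - |A| and n - |B|, and i! d! e! counts the chains through A ⊂ B.
-- Weighted by the level of B this is `n !` over C(i + d, i). From e ≤ i and k ≤ d follows n + k ≤ 2
-- (i + d), so this binomial is at least `extra`.
extra*C≤ : ∀ {k i d e} → e ≤ i → k ≤ i → k ≤ d →
           extra (i + d + e) k * ((i + d + e) C (i + d)) * (i ! * d ! * e !) ≤ (i + d + e) !
extra*C≤ {k} {i} {d} {e} e≤i k≤i k≤d = begin
  extra n k * (n C (i + d)) * (i ! * d ! * e !)     ≤⟨ *-monoˡ-≤ _ (*-monoˡ-≤ (n C (i + d)) extra≤) ⟩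
  ((i + d) C i) * (n C (i + d)) * (i ! * d ! * e !) ≡⟨ cong (_* (i ! * d ! * e !)) (*-comm ((i + d) C i) _) ⟩
  (n C (i + d)) * ((i + d) C i) * (i ! * d ! * e !) ≡⟨ C-trinomial i d e ⟩
  n !                                               ∎
  where
  open ≤-Reasoning
  n = i + d + e
  regroup : ∀ i d → i + d + (i + d) ≡ 0 + 2 * (i + d)
  regroup = solve-∀
  middle≤ : ⌈ n + k /2⌉ ≤ i + d
  middle≤ = begin
    ⌈ i + d + e + k /2⌉      ≡⟨ cong ⌈_/2⌉ (+-assoc (i + d) e k) ⟩
    ⌈ i + d + (e + k) /2⌉    ≤⟨ ⌈n/2⌉-mono (+-monoʳ-≤ (i + d) (+-mono-≤ e≤i k≤d)) ⟩
    ⌈ i + d + (i + d) /2⌉    ≡⟨ n≡⌈n+n/2⌉ (i + d) ⟨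
    i + d                    ∎
  extra≤ : extra n k ≤ (i + d) C i
  extra≤ = ≤-trans (C-monoˡ k middle≤) (C≤C-between k≤i k≤d)

-- Complementation exchanges `i` and `e`, so `e ≤ i` may be assumed, and the minimum is bounded by
-- the level farther from the middle. After the exchange the condition `k ≤ e` comes for free from
-- `k ≤ i ≤ e`.
extra*min≤ : ∀ {k i d e} → k ≤ i → k ≤ d →
             extra (i + d + e) k * (((i + d + e) C i) ⊓ ((i + d + e) C (i + d))) * (i ! * d ! * e !) ≤ (i + d + e) !
extra*min≤ {k} {i} {d} {e} k≤i k≤d with ≤-total e i
... | inj₁ e≤i = ≤-trans (*-monoˡ-≤ (i ! * d ! * e !) (*-monoʳ-≤ (extra (i + d + e) k) (m⊓n≤n ((i + d + e) C i) _))) (extra*C≤ {e = e} e≤i k≤i k≤d)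
... | inj₂ i≤e = begin
  extra n k * ((n C i) ⊓ (n C (i + d))) * (i ! * d ! * e !)  ≤⟨ *-monoˡ-≤ (i ! * d ! * e !) (*-monoʳ-≤ (extra n k) (m⊓n≤m (n C i) _)) ⟩
  extra n k * (n C i) * (i ! * d ! * e !)                ≡⟨ cong₂ _*_ (cong (extra n k *_) nCi≡) (regroup (i !) (d !) (e !)) ⟩
  extra n k * (n C (e + d)) * (e ! * d ! * i !)          ≡⟨ cong (λ m → extra m k * (m C (e + d)) * (e ! * d ! * i !)) n≡ ⟩
  extra m k * (m C (e + d)) * (e ! * d ! * i !)          ≤⟨ extra*C≤ {e = i} i≤e (≤-trans k≤i i≤e) k≤d ⟩
  m !                                                    ≡⟨ cong _! n≡ ⟨
  n !                                                    ∎
  where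
  open ≤-Reasoning
  n = i + d + e
  m = e + d + i
  n≡ : n ≡ m
  n≡ = reverse i d e
    where
    reverse : ∀ i d e → i + d + e ≡ e + d + i
    reverse = solve-∀
  regroup : ∀ a b c → a * b * c ≡ c * b * a
  regroup = solve-∀
  nCi≡ : n C i ≡ n C (e + d)
  nCi≡ = trans (cong (_C i) n≡) (trans (sym (C-sym (e + d) i)) (cong (_C (e + d)) (sym n≡)))

-- Maximal chains of the boolean lattice

-- A maximal chain ∅ = F₀ ⊂ ... ⊂ Fₙ of P(n) extends to P(n + 1) by choosing the
-- position p at which the new point enters: F₀, ..., Fₚ stay, then Fₚ, ..., Fₙ
-- receive the point.  A chain is thus a sequence of such positions.
Flag : ℕ → Set
Flag = Vec ℕ

flags : ∀ n → List (Flag n)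
flags zero    = [] ∷ []
flags (suc n) = cartesianProductWith _∷_ (upTo (suc n)) (flags n)

-- The index of a member in its chain is its size. So `∣ A ∣ ≤ p` says that A occurs no later than
-- Fₚ and still lacks the new point, and `p ≤ ∣ A ∣` that it has received it; Fₚ itself occurs in
-- both forms.
On : ∀ {n} → Flag n → Subset n → Set
On []      []            = ⊤
On (p ∷ F) (outside ∷ A) = ∣ A ∣ ≤ p × On F A
On (p ∷ F) (inside ∷ A)  = p ≤ ∣ A ∣ × On F A

on? : ∀ {n} (F : Flag n) → Decidable (On F)
on? []      []            = yes tt
on? (p ∷ F) (outside ∷ A) = (∣ A ∣ ≤? p) ×-dec on? F A
on? (p ∷ F) (inside ∷ A)  = (p ≤? ∣ A ∣) ×-dec on? F A

On-⊆ : ∀ {n} (F : Flag n) {A B : Subset n} → On F A → On F B → ∣ A ∣ ≤ ∣ B ∣ → A ⊆ B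
On-⊆ []      {[]}          {[]}          _          _          _     = id
On-⊆ (p ∷ F) {outside ∷ A} {outside ∷ B} (_ , FA)   (_ , FB)   a≤b   = out⊆ (On-⊆ F FA FB a≤b)
On-⊆ (p ∷ F) {outside ∷ A} {inside ∷ B}  (a≤p , FA) (p≤b , FB) _     = out⊆ (On-⊆ F FA FB (≤-trans a≤p p≤b))
-- The first set has size `suc ∣ A ∣`, whereas |B| ≤ p ≤ |A|.
On-⊆ (p ∷ F) {inside ∷ A}  {outside ∷ B} (p≤a , _)  (b≤p , _)  a<b   =
  contradiction (≤-trans a<b (≤-trans b≤p p≤a)) 1+n≰n
On-⊆ (p ∷ F) {inside ∷ A}  {inside ∷ B}  (_ , FA)   (_ , FB)   a≤b   = in⊆in (On-⊆ F FA FB (s≤s⁻¹ a≤b))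

On-comparable : ∀ {n} (F : Flag n) {A B : Subset n} → On F A → On F B → Comparable (A , B)
On-comparable F {A} {B} FA FB with ≤-total ∣ A ∣ ∣ B ∣
... | inj₁ a≤b = inj₁ (On-⊆ F FA FB a≤b)
... | inj₂ b≤a = inj₂ (On-⊆ F FB FA b≤a)

On-injective : ∀ {n} (F : Flag n) {A B : Subset n} → On F A → On F B → ∣ A ∣ ≡ ∣ B ∣ → A ≡ B
On-injective F FA FB a≡b =
  ⊆-antisym (On-⊆ F FA FB (≤-reflexive a≡b)) (On-⊆ F FB FA (≤-reflexive (sym a≡b)))

-- Counting the chains through given sets

length-flags : ∀ n → ∑ (flags n) (λ _ → 1) ≡ n !
length-flags zero    = refl
length-flags (suc n) = begin
  ∑ (flags (suc n)) (λ _ → 1)                             ≡⟨ ∑-cartesianProductWith _∷_ (upTo (suc n)) (flags n) _ ⟩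
  ∑ (upTo (suc n)) (λ _ → ∑ (flags n) (λ _ → 1))          ≡⟨ ∑-cong (upTo (suc n)) (λ _ → length-flags n) ⟩
  ∑ (upTo (suc n)) (λ _ → n !)                            ≡⟨ ∑-const (upTo (suc n)) (n !) ⟩
  length (upTo (suc n)) * n !                             ≡⟨ cong (_* n !) (length-upTo (suc n)) ⟩
  suc n * n !                                             ∎
  where open ≡-Reasoning

through : ∀ {n} → Subset n → Subset n → ℕ
through {n} A B = ∑ (flags n) (λ F → 𝟙 (on? F A) * 𝟙 (on? F B))

through-comm : ∀ {n} (A B : Subset n) → through A B ≡ through B A
through-comm {n} A B = ∑-cong (flags n) λ F → *-comm (𝟙 (on? F A)) (𝟙 (on? F B))

-- `count-≥`, `count-≤` and `count-between` count the entry positions of a new point that lies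
-- outside both of two nested sets, inside both, or only in the larger one.
count-≥ : ∀ m b → ∑ (upTo (b + m)) (λ p → 𝟙 (b ≤? p)) ≡ m
count-≥ m zero    = trans (∑-cong (upTo m) (λ p → 𝟙-yes (0 ≤? p) z≤n))
                          (trans (∑-const (upTo m) 1) (trans (*-identityʳ _) (length-upTo m)))
count-≥ m (suc b) = begin
  ∑ (upTo (suc (b + m))) (λ p → 𝟙 (suc b ≤? p))             ≡⟨ ∑-upTo-suc (b + m) (λ p → 𝟙 (suc b ≤? p)) ⟩
  ∑ (upTo (b + m)) (λ p → 𝟙 (suc b ≤? suc p))               ≡⟨ ∑-cong (upTo (b + m)) (λ p → 𝟙-⇔ _ (b ≤? p) s≤s⁻¹ s≤s) ⟩
  ∑ (upTo (b + m)) (λ p → 𝟙 (b ≤? p))                       ≡⟨ count-≥ m b ⟩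
  m                                                         ∎
  where open ≡-Reasoning

count-≤ : ∀ b m → ∑ (upTo (suc b + m)) (λ p → 𝟙 (p ≤? b)) ≡ suc b
count-≤ zero    m = trans (∑-upTo-suc m (λ p → 𝟙 (p ≤? 0))) (cong suc (trans
  (∑-cong (upTo m) (λ p → 𝟙-no (suc p ≤? 0) λ ())) (∑-0 (upTo m))))
count-≤ (suc b) m = trans (∑-upTo-suc (suc b + m) (λ p → 𝟙 (p ≤? suc b))) (cong suc (trans
  (∑-cong (upTo (suc b + m)) (λ p → 𝟙-⇔ (suc p ≤? suc b) (p ≤? b) s≤s⁻¹ s≤s)) (count-≤ b m)))

count-between : ∀ a d e → ∑ (upTo (suc (a + d + e))) (λ p → 𝟙 (a ≤? p) * 𝟙 (p ≤? a + d)) ≡ suc d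
count-between zero    d e = trans
  (∑-cong (upTo (suc (d + e))) (λ p → trans (cong (_* 𝟙 (p ≤? d)) (𝟙-yes (0 ≤? p) z≤n)) (+-identityʳ _)))
  (count-≤ d e)
count-between (suc a) d e = trans (∑-upTo-suc (suc (a + d + e)) (λ p → 𝟙 (suc a ≤? p) * 𝟙 (p ≤? suc (a + d)))) (trans
  (∑-cong (upTo (suc (a + d + e))) (λ p → cong₂ _*_ (𝟙-⇔ (suc a ≤? suc p) (a ≤? p) s≤s⁻¹ s≤s)
                                                   (𝟙-⇔ (suc p ≤? suc (a + d)) (p ≤? a + d) s≤s⁻¹ s≤s)))
  (count-between a d e))

𝟙-*-absorb : ∀ {p q} {P : Set p} {Q : Set q} (P? : Dec P) (Q? : Dec Q) → (P → Q) → 𝟙 P? * 𝟙 Q? ≡ 𝟙 P?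
𝟙-*-absorb (yes p) Q? P⇒Q = cong (_+ 0) (𝟙-yes Q? (P⇒Q p))
𝟙-*-absorb (no _)  Q? _   = refl

-- Membership in the chain `p ∷ F` is a condition on `p` alone together with one on `F` alone, so
-- the count factors.
∑-flags-suc : ∀ {n} (x y : ℕ → ℕ) (f g : Flag n → ℕ) →
  ∑ (upTo (suc n)) (λ p → ∑ (flags n) (λ F → (x p * f F) * (y p * g F)))
  ≡ ∑ (upTo (suc n)) (λ p → x p * y p) * ∑ (flags n) (λ F → f F * g F)
∑-flags-suc {n} x y f g = trans
  (∑-cong (upTo (suc n)) (λ p → trans
    (∑-cong (flags n) (λ F → interchange (x p) (f F) (y p) (g F)))
    (∑-*ˡ (flags n) (λ F → f F * g F) (x p * y p))))
  (∑-*ʳ (upTo (suc n)) (λ p → x p * y p) _)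
  where
  interchange : ∀ a b c d → (a * b) * (c * d) ≡ (a * c) * (b * d)
  interchange = solve-∀

-- A chain through A ⊂ B orders the points of A, of B outside A, and of the complement of B
-- independently. In the induction the new point falls into one of these three zones, and its number
-- of positions is the next factor of that zone's factorial.
through-⊆ : ∀ {n} {A B : Subset n} {d e} → A ⊆ B → ∣ A ∣ + d ≡ ∣ B ∣ → ∣ B ∣ + e ≡ n →
            through A B ≡ ∣ A ∣ ! * d ! * e !
through-⊆ {zero} {[]} {[]} {zero} {zero} _ _ _ = refl
through-⊆ {suc n} {s ∷ A} {t ∷ B} {d} {e} A⊆B a+d≡b b+e≡n = trans expand (split s t d e A⊆B a+d≡b b+e≡n)
  where
  open ≡-Reasoning
  x : ∀ {n} → Side → Subset n → ℕ → ℕ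
  x outside A p = 𝟙 (∣ A ∣ ≤? p)
  x inside  A p = 𝟙 (p ≤? ∣ A ∣)
  𝟙-on : ∀ {n} s (A : Subset n) p F → 𝟙 (on? (p ∷ F) (s ∷ A)) ≡ x s A p * 𝟙 (on? F A)
  𝟙-on outside A p F = 𝟙-× (∣ A ∣ ≤? p) (on? F A)
  𝟙-on inside  A p F = 𝟙-× (p ≤? ∣ A ∣) (on? F A)
  expand : through (s ∷ A) (t ∷ B) ≡ ∑ (upTo (suc n)) (λ p → x s A p * x t B p) * through A B
  expand = begin
    through (s ∷ A) (t ∷ B)
      ≡⟨ ∑-cartesianProductWith _∷_ (upTo (suc n)) (flags n) _ ⟩
    ∑ (upTo (suc n)) (λ p → ∑ (flags n) (λ F → 𝟙 (on? (p ∷ F) (s ∷ A)) * 𝟙 (on? (p ∷ F) (t ∷ B))))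
      ≡⟨ ∑-cong (upTo (suc n)) (λ p → ∑-cong (flags n) (λ F → cong₂ _*_ (𝟙-on s A p F) (𝟙-on t B p F))) ⟩
    ∑ (upTo (suc n)) (λ p → ∑ (flags n) (λ F → (x s A p * 𝟙 (on? F A)) * (x t B p * 𝟙 (on? F B))))
      ≡⟨ ∑-flags-suc (x s A) (x t B) (λ F → 𝟙 (on? F A)) (λ F → 𝟙 (on? F B)) ⟩
    ∑ (upTo (suc n)) (λ p → x s A p * x t B p) * through A B ∎
  at-n : ∀ {m} (f : ℕ → ℕ) → suc n ≡ m → ∑ (upTo (suc n)) f ≡ ∑ (upTo m) f
  at-n f eq = cong (λ m → ∑ (upTo m) f) eq
  split : ∀ s t d e → (s ∷ A) ⊆ (t ∷ B) → ∣ s ∷ A ∣ + d ≡ ∣ t ∷ B ∣ → ∣ t ∷ B ∣ + e ≡ suc n →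
          ∑ (upTo (suc n)) (λ p → x s A p * x t B p) * through A B ≡ ∣ s ∷ A ∣ ! * d ! * e !
  split outside outside d zero A⊆B a+d≡b b+e≡n = contradiction (≤-trans (≤-reflexive (sym (trans (sym (+-identityʳ _)) b+e≡n))) (∣p∣≤n B)) 1+n≰n
  split outside outside d (suc e′) A⊆B a+d≡b b+e≡n = begin
    ∑ (upTo (suc n)) (λ p → 𝟙 (∣ A ∣ ≤? p) * 𝟙 (∣ B ∣ ≤? p)) * through A B
      ≡⟨ cong₂ _*_ (∑-cong (upTo (suc n)) (λ p → trans (*-comm (𝟙 (∣ A ∣ ≤? p)) _)
           (𝟙-*-absorb (∣ B ∣ ≤? p) (∣ A ∣ ≤? p) (≤-trans (m+n≤o⇒m≤o ∣ A ∣ (≤-reflexive a+d≡b))))))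
           (through-⊆ (drop-∷-⊆ A⊆B) a+d≡b (suc-injective (trans (sym (+-suc ∣ B ∣ e′)) b+e≡n))) ⟩
    ∑ (upTo (suc n)) (λ p → 𝟙 (∣ B ∣ ≤? p)) * (∣ A ∣ ! * d ! * e′ !)
      ≡⟨ cong (_* (∣ A ∣ ! * d ! * e′ !)) (trans (at-n (λ p → 𝟙 (∣ B ∣ ≤? p)) (sym b+e≡n)) (count-≥ (suc e′) ∣ B ∣)) ⟩
    suc e′ * (∣ A ∣ ! * d ! * e′ !)
      ≡⟨ regroup (suc e′) (∣ A ∣ ! * d !) (e′ !) ⟩
    ∣ A ∣ ! * d ! * suc e′ ! ∎
    where
    regroup : ∀ a b c → a * (b * c) ≡ b * (a * c)
    regroup = solve-∀
  split outside inside zero e A⊆B a+d≡b b+e≡n = contradiction (≤-trans (≤-reflexive (sym (trans (sym (+-identityʳ _)) a+d≡b)))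
                   (p⊆q⇒∣p∣≤∣q∣ (drop-∷-⊆ A⊆B))) 1+n≰n
  split outside inside (suc d′) e A⊆B a+d≡b b+e≡n = begin
    ∑ (upTo (suc n)) (λ p → 𝟙 (∣ A ∣ ≤? p) * 𝟙 (p ≤? ∣ B ∣)) * through A B
      ≡⟨ cong₂ _*_ (trans (cong₂ (λ m b → ∑ (upTo m) (λ p → 𝟙 (∣ A ∣ ≤? p) * 𝟙 (p ≤? b)))
             (trans (sym b+e≡n) (cong (λ b → suc (b + e)) (sym a+d′≡b))) (sym a+d′≡b)) (count-between ∣ A ∣ d′ e))
           (through-⊆ (drop-∷-⊆ A⊆B) a+d′≡b (suc-injective b+e≡n)) ⟩
    suc d′ * (∣ A ∣ ! * d′ ! * e !)
      ≡⟨ regroup (suc d′) (∣ A ∣ !) (d′ !) (e !) ⟩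
    ∣ A ∣ ! * suc d′ ! * e ! ∎
    where
    a+d′≡b : ∣ A ∣ + d′ ≡ ∣ B ∣
    a+d′≡b = suc-injective (trans (sym (+-suc ∣ A ∣ d′)) a+d≡b)
    regroup : ∀ s a b c → s * (a * b * c) ≡ a * (s * b) * c
    regroup = solve-∀
  split inside outside d e A⊆B _ _ with A⊆B here
  ... | ()
  split inside inside d e A⊆B a+d≡b b+e≡n = begin
    ∑ (upTo (suc n)) (λ p → 𝟙 (p ≤? ∣ A ∣) * 𝟙 (p ≤? ∣ B ∣)) * through A B
      ≡⟨ cong₂ _*_ (∑-cong (upTo (suc n)) (λ p →
           𝟙-*-absorb (p ≤? ∣ A ∣) (p ≤? ∣ B ∣) (λ p≤a → ≤-trans p≤a (m+n≤o⇒m≤o ∣ A ∣ (≤-reflexive (suc-injective a+d≡b))))))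
           (through-⊆ (drop-∷-⊆ A⊆B) (suc-injective a+d≡b) (suc-injective b+e≡n)) ⟩
    ∑ (upTo (suc n)) (λ p → 𝟙 (p ≤? ∣ A ∣)) * (∣ A ∣ ! * d ! * e !)
      ≡⟨ cong (_* (∣ A ∣ ! * d ! * e !)) (trans (at-n (λ p → 𝟙 (p ≤? ∣ A ∣)) n≡) (count-≤ ∣ A ∣ (d + e))) ⟩
    suc ∣ A ∣ * (∣ A ∣ ! * d ! * e !)
      ≡⟨ regroup (suc ∣ A ∣) (∣ A ∣ !) (d !) (e !) ⟩
    suc ∣ A ∣ ! * d ! * e ! ∎
    where
    n≡ : suc n ≡ suc ∣ A ∣ + (d + e)
    n≡ = sym (trans (sym (+-assoc (suc ∣ A ∣) d e)) (trans (cong (_+ e) a+d≡b) b+e≡n))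
    regroup : ∀ s a b c → s * (a * b * c) ≡ s * a * b * c
    regroup = solve-∀

through-incomparable : ∀ {n} (A B : Subset n) → ¬ Comparable (A , B) → through A B ≡ 0
through-incomparable {n} A B A≁B = trans (∑-cong (flags n) vanish) (∑-0 (flags n))
  where
  vanish : ∀ F → 𝟙 (on? F A) * 𝟙 (on? F B) ≡ 0
  vanish F with on? F A | on? F B
  ... | no _   | _     = refl
  ... | yes _  | no _  = refl
  ... | yes FA | yes FB = ⊥-elim (A≁B (On-comparable F FA FB))

∑-on : ∀ {n} (A : Subset n) {e} → ∣ A ∣ + e ≡ n → ∑ (flags n) (λ F → 𝟙 (on? F A)) ≡ ∣ A ∣ ! * e !
∑-on {n} A {e} a+e≡n = begin
  ∑ (flags n) (λ F → 𝟙 (on? F A))   ≡⟨ ∑-cong (flags n) (λ F → 𝟙-*-absorb (on? F A) (on? F A) id) ⟨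
  through A A                       ≡⟨ through-⊆ {A = A} ⊆-refl (+-identityʳ ∣ A ∣) a+e≡n ⟩
  ∣ A ∣ ! * 1 * e !                 ≡⟨ cong (_* e !) (*-identityʳ (∣ A ∣ !)) ⟩
  ∣ A ∣ ! * e !                     ∎
  where open ≡-Reasoning

-- Levels ranked by their distance from the middle

i+i≢1+j+j : ∀ i j → i + i ≢ suc (j + j)
i+i≢1+j+j i j eq = 1+n≢n (trans (sym eq) (cong (λ m → m + m) i≡j))
  where
  i≡j : i ≡ j
  i≡j = trans (n≡⌊n+n/2⌋ i) (trans (cong ⌊_/2⌋ eq) (sym (n≡⌈n+n/2⌉ j)))

i+i≡j+j⇒i≡j : ∀ {i j} → i + i ≡ j + j → i ≡ j
i+i≡j+j⇒i≡j {i} {j} eq = trans (n≡⌊n+n/2⌋ i) (trans (cong ⌊_/2⌋ eq) (sym (n≡⌊n+n/2⌋ j)))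

i+i<j+j⇒i<j : ∀ {i j} → i + i < j + j → i < j
i+i<j+j⇒i<j lt = ≰⇒> λ j≤i → <⇒≱ lt (+-mono-≤ j≤i j≤i)

-- Counting outward from the middle, with the upper level first at equal distance,
-- so that the first k levels are those summed by middleLayers.  One of the two
-- truncated differences is always 0.
rank : ℕ → ℕ → ℕ
rank n j = (j + j ∸ suc n) + (n ∸ (j + j))

rank-view : ∀ n j → (j + j + rank n j ≡ n) ⊎ (suc n + rank n j ≡ j + j)
rank-view n j with j + j ≤? n
... | yes 2j≤n = inj₁ (trans (cong (λ z → j + j + (z + (n ∸ (j + j)))) (m≤n⇒m∸n≡0 (m≤n⇒m≤1+n 2j≤n)))
                             (m+[n∸m]≡n 2j≤n))
... | no 2j≰n  = inj₂ (trans (cong (λ z → suc n + (j + j ∸ suc n + z)) (m≤n⇒m∸n≡0 (≰⇒≥ 2j≰n)))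
                      (trans (cong (suc n +_) (+-identityʳ _)) (m+[n∸m]≡n (≰⇒> 2j≰n))))

-- Ranks of levels in the lower half have the parity of n, those in the upper half the opposite
-- parity. So equal ranks force the same half, where the rank determines the level.
rank-injective : ∀ {n i j} → rank n i ≡ rank n j → i ≡ j
rank-injective {n} {i} {j} eq with rank n i | rank n j | rank-view n i | rank-view n j
... | r | s | inj₁ p | inj₁ q = i+i≡j+j⇒i≡j (+-cancelʳ-≡ r _ _ (trans p (trans (sym q) (cong (j + j +_) (sym eq)))))
... | r | s | inj₂ p | inj₂ q = i+i≡j+j⇒i≡j (trans (sym p) (trans (cong (suc n +_) eq) q))
... | r | s | inj₁ p | inj₂ q = contradiction
        (trans (sym q) (trans (cong₂ (λ n s → suc n + s) (sym p) (sym eq)) (regroup i r))) (i+i≢1+j+j j (i + r))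
  where
  regroup : ∀ i r → suc (i + i + r) + r ≡ suc ((i + r) + (i + r))
  regroup = solve-∀
... | r | s | inj₂ p | inj₁ q = contradiction
        (trans (sym p) (trans (cong₂ (λ n r → suc n + r) (sym q) eq) (regroup j s))) (i+i≢1+j+j i (j + s))
  where
  regroup : ∀ i r → suc (i + i + r) + r ≡ suc ((i + r) + (i + r))
  regroup = solve-∀

-- The levels of smaller rank form an interval around the middle. A level in the lower half has all
-- of them above it, a level in the upper half all of them below.
rank<⇒same-side : ∀ n i → (∀ j → rank n j < rank n i → i < j) ⊎ (∀ j → rank n j < rank n i → j < i)
rank<⇒same-side n i with rank-view n i
... | inj₁ p = inj₁ λ j s<r → i+i<j+j⇒i<j (above j s<r)
  where
  open ≤-Reasoning
  above : ∀ j → rank n j < rank n i → i + i < j + j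
  above j s<r with rank-view n j
  ... | inj₁ q = +-cancelʳ-< (rank n j) (i + i) (j + j) (begin-strict
        i + i + rank n j  <⟨ +-monoʳ-< (i + i) s<r ⟩
        i + i + rank n i  ≡⟨ trans p (sym q) ⟩
        j + j + rank n j  ∎)
  ... | inj₂ q = begin-strict
        i + i             ≤⟨ m+n≤o⇒m≤o (i + i) (≤-reflexive p) ⟩
        n                 <⟨ m+n≤o⇒m≤o (suc n) (≤-reflexive q) ⟩
        j + j             ∎
... | inj₂ p = inj₂ λ j s<r → i+i<j+j⇒i<j (below j s<r)
  where
  open ≤-Reasoning
  below : ∀ j → rank n j < rank n i → j + j < i + i
  below j s<r with rank-view n j
  ... | inj₁ q = begin-strict
        j + j             ≤⟨ m+n≤o⇒m≤o (j + j) (≤-reflexive q) ⟩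
        n                 <⟨ m+n≤o⇒m≤o (suc n) (≤-reflexive p) ⟩
        i + i             ∎
  ... | inj₂ q = begin-strict
        j + j             ≡⟨ q ⟨
        suc n + rank n j  <⟨ +-monoʳ-< (suc n) s<r ⟩
        suc n + rank n i  ≡⟨ p ⟩
        i + i             ∎

-- The size of the level of rank `r`: the index ⌊(n - r)/2⌋ is that level itself in the lower half,
-- and its mirror image in the upper half.
layer : ℕ → ℕ → ℕ
layer n r = n C ⌊ n ∸ r /2⌋

layer-antitone : ∀ n {r s} → r ≤ s → layer n s ≤ layer n r
layer-antitone n {r} {s} r≤s = C-mono-below-middle (⌊n/2⌋-mono (∸-monoʳ-≤ n r≤s)) (begin
  ⌊ n ∸ r /2⌋ + ⌊ n ∸ r /2⌋  ≤⟨ +-monoʳ-≤ ⌊ n ∸ r /2⌋ (⌊n/2⌋≤⌈n/2⌉ (n ∸ r)) ⟩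
  ⌊ n ∸ r /2⌋ + ⌈ n ∸ r /2⌉  ≡⟨ ⌊n/2⌋+⌈n/2⌉≡n (n ∸ r) ⟩
  n ∸ r                      ≤⟨ m∸n≤m n r ⟩
  n                          ∎)
  where open ≤-Reasoning

C≡layer-rank : ∀ {n j} → j ≤ n → n C j ≡ layer n (rank n j)
C≡layer-rank {n} {j} j≤n with rank-view n j
... | inj₁ p = cong (n C_) (trans (n≡⌊n+n/2⌋ j) (cong ⌊_/2⌋ (sym (trans
        (cong (_∸ rank n j) (sym p)) (m+n∸n≡m (j + j) (rank n j))))))
... | inj₂ p with m≤n⇒∃[o]m+o≡n j≤n
...   | e , refl = trans (C-sym j e) (cong ((j + e) C_) (trans (n≡⌈n+n/2⌉ e) (cong ⌊_/2⌋ (sym n∸r≡))))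
  where
  r = rank (j + e) j
  j≡ : suc (e + r) ≡ j
  j≡ = +-cancelˡ-≡ j _ _ (trans (regroup j e r) p)
    where
    regroup : ∀ j e r → j + suc (e + r) ≡ suc (j + e) + r
    regroup = solve-∀
  n∸r≡ : j + e ∸ r ≡ suc (e + e)
  n∸r≡ = trans (cong (λ z → z + e ∸ r) (sym j≡)) (trans (cong (_∸ r) (regroup e r)) (m+n∸n≡m (suc (e + e)) r))
    where
    regroup : ∀ e r → suc (e + r) + e ≡ suc (e + e) + r
    regroup = solve-∀

-- The middle layers are those of least rank

layers-from : ℕ → ℕ → ℕ → ℕ
layers-from n l k = ∑ (upTo k) (λ r → n C (l + r))

-- The induction keeps n = k + d fixed and peels off the level of greatest rank. The parity of `d`
-- decides whether this is the top of the interval (d even) or its bottom (d odd).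
layers-from-middle : ∀ k d → layers-from (k + d) ⌈ suc d /2⌉ k ≡ ∑ (upTo k) (layer (k + d))
layers-from-middle zero    d = refl
layers-from-middle (suc k) d = begin
  layers-from n ⌈ suc d /2⌉ (suc k)                       ≡⟨ extend (even-or-odd d) ⟩
  layers-from n ⌈ suc (suc d) /2⌉ k + layer n k           ≡⟨ cong (_+ layer n k)
                                                              (subst (λ n → layers-from n ⌈ suc (suc d) /2⌉ k ≡ ∑ (upTo k) (layer n))
                                                                     (+-suc k d) (layers-from-middle k (suc d))) ⟩
  ∑ (upTo k) (layer n) + layer n k                        ≡⟨ ∑-upTo-last k (layer n) ⟨
  ∑ (upTo (suc k)) (layer n)                              ∎
  where
  open ≡-Reasoning
  n = suc k + d
  n∸k≡ : n ∸ k ≡ suc d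
  n∸k≡ = trans (cong (_∸ k) (sym (+-suc k d))) (m+n∸m≡n k (suc d))
  even-or-odd : ∀ d → ∃ λ u → d ≡ u + u ⊎ d ≡ suc (u + u)
  even-or-odd zero = 0 , inj₁ refl
  even-or-odd (suc d) with even-or-odd d
  ... | u , inj₁ refl = u , inj₂ refl
  ... | u , inj₂ refl = suc u , inj₁ (cong suc (sym (+-suc u u)))
  extend : (∃ λ u → d ≡ u + u ⊎ d ≡ suc (u + u)) →
           layers-from n ⌈ suc d /2⌉ (suc k) ≡ layers-from n ⌈ suc (suc d) /2⌉ k + layer n k
  extend (u , inj₁ refl) = begin
    layers-from n (suc ⌊ u + u /2⌋) (suc k)                   ≡⟨ cong (λ l → layers-from n (suc l) (suc k)) (n≡⌊n+n/2⌋ u) ⟨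
    layers-from n (suc u) (suc k)                             ≡⟨ ∑-upTo-last k (λ r → n C (suc u + r)) ⟩
    layers-from n (suc u) k + n C (suc u + k)                 ≡⟨ cong₂ (λ l c → layers-from n (suc l) k + c) (n≡⌈n+n/2⌉ u) top ⟩
    layers-from n (suc ⌈ u + u /2⌉) k + layer n k             ∎
    where
    top : n C (suc u + k) ≡ layer n k
    top = begin
      n C (suc u + k)            ≡⟨ cong (_C (suc u + k)) (regroup k u) ⟩
      (suc u + k + u) C (suc u + k) ≡⟨ C-sym (suc u + k) u ⟩
      (suc u + k + u) C u        ≡⟨ cong₂ _C_ (sym (regroup k u)) (trans (n≡⌈n+n/2⌉ u) (cong ⌊_/2⌋ (sym n∸k≡))) ⟩
      layer n k                  ∎
      where
      regroup : ∀ k u → suc k + (u + u) ≡ suc u + k + u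
      regroup = solve-∀
  extend (u , inj₂ refl) = begin
    layers-from n (suc ⌈ u + u /2⌉) (suc k)                   ≡⟨ cong (λ l → layers-from n (suc l) (suc k)) (n≡⌈n+n/2⌉ u) ⟨
    layers-from n (suc u) (suc k)                             ≡⟨ ∑-upTo-suc k (λ r → n C (suc u + r)) ⟩
    n C (suc u + 0) + ∑ (upTo k) (λ r → n C (suc u + suc r))  ≡⟨ cong₂ _+_ bottom (∑-cong (upTo k) λ r → cong (n C_) (+-suc (suc u) r)) ⟩
    layer n k + layers-from n (suc (suc u)) k                 ≡⟨ +-comm (layer n k) _ ⟩
    layers-from n (suc (suc u)) k + layer n k                 ≡⟨ cong (λ l → layers-from n (suc (suc l)) k + layer n k) (n≡⌊n+n/2⌋ u) ⟩
    layers-from n (suc (suc ⌊ u + u /2⌋)) k + layer n k       ∎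
    where
    bottom : n C (suc u + 0) ≡ layer n k
    bottom = cong (n C_) (trans (cong suc (trans (+-identityʳ u) (n≡⌊n+n/2⌋ u))) (cong ⌊_/2⌋ (sym n∸k≡)))

middleLayers≡∑layer : ∀ {n k} → k ≤ n → middleLayers n k ≡ ∑ (upTo k) (layer n)
middleLayers≡∑layer {n} {k} k≤n with m≤n⇒∃[o]m+o≡n k≤n
... | d , refl = trans (∑-cong (upTo k) λ r → cong ((k + d) C_) (index r)) (layers-from-middle k d)
  where
  index : ∀ r → ⌈ (suc (k + d) ∸ k) + 2 * r /2⌉ ≡ ⌈ suc d /2⌉ + r
  index r = trans (cong (λ z → ⌈ z + 2 * r /2⌉) (trans (cong (_∸ k) (sym (+-suc k d))) (m+n∸m≡n k (suc d))))
                  (⌊m+2n/2⌋ (suc (suc d)) r)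

-- The inequality along one chain

weight : ℕ → ℕ → ℕ → ℕ → ℕ
weight n k a b = 𝟙 (k ≤? ∣ a - b ∣) * ((n C a) ⊓ (n C b))

-- The other levels all lie on the same side of the outermost one, so at most k of
-- them are within distance k of it.
far-level : ∀ {n k x xs} → AllPairs (λ i j → rank n i > rank n j) (x ∷ xs) → suc k ≤ length xs →
            Any (λ y → suc k ≤ ∣ x - y ∣) xs
far-level {n} {k} {x} {xs} (x> ∷ sorted) k<len with Any.any? (λ y → suc k ≤? ∣ x - y ∣) xs
... | yes far = far
... | no ¬far = contradiction k<len (≤⇒≯ (bound (rank<⇒same-side n x)))
  where
  near : All (λ y → ∣ x - y ∣ ≤ k) xs
  near = All.map (λ ¬k< → s≤s⁻¹ (≰⇒> ¬k<)) (All.¬Any⇒All¬ xs ¬far)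
  unique : Unique xs
  unique = AllPairs.map (λ r>s i≡j → <⇒≢ r>s (cong (rank n) (sym i≡j))) sorted
  bound : (∀ j → rank n j < rank n x → x < j) ⊎ (∀ j → rank n j < rank n x → j < x) → length xs ≤ k
  bound (inj₁ above) = unique-interval⇒length≤ {m = suc x} unique
    (All.map (above _) x>)
    (All.map (λ {y} near → s≤s (≤-trans (m≤n+∣n-m∣ y x) (+-monoʳ-≤ x near))) near)
  bound (inj₂ below) = unique-interval⇒length≤ {m = x ∸ k} unique
    (All.map (λ {y} near → m≤n+o⇒m∸n≤o x k (≤-trans (m≤∣m-n∣+n x y) (+-monoˡ-≤ y near))) near)
    (All.map (λ {y} y<x → <-≤-trans (below y y<x) (subst (x ≤_) (+-comm k (x ∸ k)) (m≤n+m∸n x k))) x>)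

≤∑-Any : ∀ {xs : List A} {f : A → ℕ} {m} → Any (λ x → m ≤ f x) xs → m ≤ ∑ xs f
≤∑-Any (here m≤)  = ≤-trans m≤ (m≤m+n _ _)
≤∑-Any (there m≤) = ≤-trans (≤∑-Any m≤) (m≤n+m _ _)

-- The bound `m` on the ranks is 0 for a general chain, and 2 for a chain on which S misses the two
-- most central levels. At most `suc k` levels have distinct ranks from `m` on and are compared with
-- the first ones; in a longer list the head is charged to a pair and removed.
chain-inequality-sorted : ∀ {n k m} ls → AllPairs (λ i j → rank n i > rank n j) ls →
  All (_≤ n) ls → All (λ j → m ≤ rank n j) ls →
  ∑ ls (n C_) ≤ ∑ (upTo (suc k)) (λ i → layer n (m + i)) + ∑₂ ls (weight n (suc k))
chain-inequality-sorted []  _ _ _ = z≤n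
chain-inequality-sorted {n} {k} {m} (x ∷ xs) sorted@(x> ∷ sorted′) ≤n@(x≤n ∷ xs≤n) m≤@(_ ∷ m≤′)
  with suc k ≤? length xs
... | no k≮ = ≤-trans (begin
  ∑ (x ∷ xs) (n C_)                              ≡⟨ sum-rank (x ∷ xs) ≤n ⟩
  ∑ (map (rank n) (x ∷ xs)) (layer n)            ≤⟨ ∑-decreasing≤ (layer-antitone n) _ (AllPairs.map⁺ sorted) (All.map⁺ m≤)
                                                     (subst (_≤ suc k) (sym (length-map (rank n) (x ∷ xs))) (≰⇒> k≮)) ⟩
  ∑ (upTo (suc k)) (λ i → layer n (m + i))       ∎) (m≤m+n _ _)
  where
  open ≤-Reasoning
  sum-rank : ∀ ls → All (_≤ n) ls → ∑ ls (n C_) ≡ ∑ (map (rank n) ls) (layer n)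
  sum-rank []       []           = refl
  sum-rank (l ∷ ls) (l≤n ∷ ls≤n) = cong₂ _+_ (C≡layer-rank l≤n) (sum-rank ls ls≤n)
... | yes k< = begin
  n C x + ∑ xs (n C_)                                    ≤⟨ +-mono-≤ pay (chain-inequality-sorted {m = m} xs sorted′ xs≤n m≤′) ⟩
  ∑ xs (w x) + (M + ∑₂ xs w)                             ≡⟨ regroup (∑ xs (w x)) M (∑₂ xs w) ⟩
  M + (∑ xs (w x) + ∑₂ xs w)                             ≡⟨ cong (M +_) (∑₂-∷ x xs w) ⟨
  M + ∑₂ (x ∷ xs) w                                      ∎
  where
  open ≤-Reasoning
  w = weight n (suc k)
  M = ∑ (upTo (suc k)) (λ i → layer n (m + i))
  regroup : ∀ a b c → a + (b + c) ≡ b + (a + c)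
  regroup = solve-∀
  pay : n C x ≤ ∑ xs (w x)
  pay = ≤∑-Any (go x> xs≤n (far-level {n} {k} sorted k<))
    where
    go : ∀ {ys} → All (λ y → rank n y < rank n x) ys → All (_≤ n) ys →
         Any (λ y → suc k ≤ ∣ x - y ∣) ys → Any (λ y → n C x ≤ w x y) ys
    go (y<x ∷ _) (y≤n ∷ _) (here {y} far) = here (begin
      n C x                     ≤⟨ ⊓-glb ≤-refl (subst₂ _≤_ (sym (C≡layer-rank x≤n)) (sym (C≡layer-rank y≤n))
                                                 (layer-antitone n (<⇒≤ y<x))) ⟩
      (n C x) ⊓ (n C y)         ≡⟨ +-identityʳ _ ⟨
      1 * ((n C x) ⊓ (n C y))   ≡⟨ cong (_* ((n C x) ⊓ (n C y))) (𝟙-yes (suc k ≤? ∣ x - y ∣) far) ⟨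
      w x y                     ∎)
    go (_ ∷ <x) (_ ∷ ≤n) (there far) = there (go <x ≤n far)

weight-comm : ∀ n k a b → weight n k a b ≡ weight n k b a
weight-comm n k a b = cong₂ _*_ (cong (λ d → 𝟙 (k ≤? d)) (∣-∣-comm a b)) (⊓-comm (n C a) (n C b))

chain-inequality : ∀ {n k} m ls → Unique ls → All (_≤ n) ls → All (λ j → m ≤ rank n j) ls →
  ∑ ls (n C_) ≤ ∑ (upTo (suc k)) (λ i → layer n (m + i)) + ∑₂ ls (weight n (suc k))
chain-inequality {n} {k} m ls unique ≤n m≤ with sort-by (rank n) ls (AllPairs.map (λ i≢j → i≢j ∘ rank-injective) unique)
... | ls′ , p , sorted = subst₂ _≤_ (sym (∑-↭ (n C_) p))
        (cong (∑ (upTo (suc k)) (λ i → layer n (m + i)) +_) (sym (∑₂-↭ _ (weight-comm n (suc k)) p)))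
        (chain-inequality-sorted ls′ sorted (All-resp-↭ p ≤n) (All-resp-↭ p m≤))

-- Estimates for large n

1+n≤2^n : ∀ n → suc n ≤ 2 ^ n
1+n≤2^n zero    = ≤-refl
1+n≤2^n (suc n) = begin
  suc (suc n)        ≤⟨ +-mono-≤ (m^n>0 2 n) (1+n≤2^n n) ⟩
  2 ^ n + 2 ^ n      ≡⟨ cong (2 ^ n +_) (+-identityʳ (2 ^ n)) ⟨
  2 ^ suc n          ∎
  where open ≤-Reasoning

-- With u = d + d² + w, the exponent splits into d and d² + w, and (1 + d)(1 + d² + w) already
-- exceeds d (1 + u).
d*[1+u]≤2^u : ∀ d {u} → d + d * d ≤ u → d * suc u ≤ 2 ^ u
d*[1+u]≤2^u d u≥ with m≤n⇒∃[o]m+o≡n u≥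
... | w , refl = begin
  d * suc (d + d * d + w)                   ≤⟨ m≤m+n _ (suc w) ⟩
  d * suc (d + d * d + w) + suc w           ≡⟨ expand d w ⟩
  suc d * suc (d * d + w)                   ≤⟨ *-mono-≤ (1+n≤2^n d) (1+n≤2^n (d * d + w)) ⟩
  2 ^ d * 2 ^ (d * d + w)                   ≡⟨ ^-distribˡ-+-* 2 d (d * d + w) ⟨
  2 ^ (d + (d * d + w))                     ≡⟨ cong (2 ^_) (+-assoc d (d * d) w) ⟨
  2 ^ (d + d * d + w)                       ∎
  where
  open ≤-Reasoning
  expand : ∀ d w → d * suc (d + d * d + w) + suc w ≡ suc d * suc (d * d + w)
  expand = solve-∀

-- With u = ⌊m / d⌋ one has m ≤ d (1 + u) ≤ 2^u, and the d-th power of this is at most 2^m.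
m^d≤2^m : ∀ d → .{{_ : NonZero d}} → ∃ λ m₀ → ∀ m → m₀ ≤ m → m ^ d ≤ 2 ^ m
m^d≤2^m d = (d + d * d) * d , bound
  where
  open ≤-Reasoning
  bound : ∀ m → (d + d * d) * d ≤ m → m ^ d ≤ 2 ^ m
  bound m m₀≤m = begin
    m ^ d             ≤⟨ ^-monoˡ-≤ d (≤-trans m≤ (d*[1+u]≤2^u d (subst (_≤ u) (m*n/n≡m (d + d * d) d) (/-monoˡ-≤ d m₀≤m)))) ⟩
    (2 ^ u) ^ d       ≡⟨ ^-*-assoc 2 u d ⟩
    2 ^ (u * d)       ≤⟨ ^-monoʳ-≤ 2 (m/n*n≤m m d) ⟩
    2 ^ m             ∎
    where
    u = m / d
    m≤ : m ≤ d * suc u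
    m≤ = begin
      m               ≡⟨ m≡m%n+[m/n]*n m d ⟩
      m % d + u * d   ≤⟨ +-monoˡ-≤ (u * d) (<⇒≤ (m%n<n m d)) ⟩
      d + u * d       ≡⟨ cong (d +_) (*-comm u d) ⟩
      d + d * u       ≡⟨ *-suc d u ⟨
      d * suc u       ∎

-- 2^q is a lower bound for the central binomials in play. The exponent 3 + 2k collects the
-- polynomial losses: one factor n + 1 from `layer₀≤gain`, two from the number of pairs on a chain,
-- k from the weight of an exceptional pair, and k from the level of a low set.
record Large (k n : ℕ) : Set where
  field
    q       : ℕ
    q+k≤n/2 : q + k ≤ ⌊ n /2⌋
    2s^D≤2^q : 2 * suc n ^ (3 + (k + k)) ≤ 2 ^ q

n≤1+2⌊n/2⌋ : ∀ n → n ≤ suc (⌊ n /2⌋ + ⌊ n /2⌋)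
n≤1+2⌊n/2⌋ n = begin
  n                            ≡⟨ ⌊n/2⌋+⌈n/2⌉≡n n ⟨
  ⌊ n /2⌋ + ⌈ n /2⌉            ≤⟨ +-monoʳ-≤ ⌊ n /2⌋ (⌊n/2⌋-mono (n≤1+n (suc n))) ⟩
  ⌊ n /2⌋ + suc ⌊ n /2⌋        ≡⟨ +-suc _ _ ⟩
  suc (⌊ n /2⌋ + ⌊ n /2⌋)      ∎
  where open ≤-Reasoning

eventually-large : ∀ k → ∃ λ n₀ → ∀ n → n₀ ≤ n → Large k n
eventually-large k = (k + Q) + (k + Q) , large
  where
  open ≤-Reasoning
  D = 3 + (k + k)
  -- Since n + 1 ≤ q², the power (n + 1)^D costs 2D factors q; one more absorbs the constant 2.
  exp-wins = m^d≤2^m (suc (D + D))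
  m₀ = proj₁ exp-wins
  -- The second summand is 2k + 4, which makes 1 + n ≤ 2 + 2 (q + k) ≤ (2k + 4) q ≤ q².
  Q = m₀ + (2 + (k + (k + 2)))
  large : ∀ n → (k + Q) + (k + Q) ≤ n → Large k n
  large n n₀≤n with m≤n⇒∃[o]m+o≡n (subst (_≤ ⌊ n /2⌋) (sym (n≡⌊n+n/2⌋ (k + Q))) (⌊n/2⌋-mono n₀≤n))
  ... | w , k+Q+w≡ = record
    { q        = q
    ; q+k≤n/2  = ≤-reflexive q+k≡
    ; 2s^D≤2^q = begin
        2 * suc n ^ D            ≤⟨ *-mono-≤ (≤-trans (m≤m+n 2 _) c≤q) (^-monoˡ-≤ D s≤q²) ⟩
        q * (q * q) ^ D          ≡⟨ cong (λ z → q * (q * z) ^ D) (*-identityʳ q) ⟨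
        q * (q ^ 2) ^ D          ≡⟨ cong (q *_) (^-*-assoc q 2 D) ⟩
        q * q ^ (2 * D)          ≡⟨ cong (λ e → q * q ^ (D + e)) (+-identityʳ D) ⟩
        q ^ suc (D + D)          ≤⟨ proj₂ exp-wins q (≤-trans (m≤m+n m₀ _) (m≤m+n Q w)) ⟩
        2 ^ q                    ∎
    }
    where
    q = Q + w
    q+k≡ : q + k ≡ ⌊ n /2⌋
    q+k≡ = trans (+-comm q k) (trans (sym (+-assoc k Q w)) k+Q+w≡)
    c = 2 + (k + (k + 2))
    c≤q : c ≤ q
    c≤q = ≤-trans (m≤n+m c m₀) (m≤m+n Q w)
    s≤q² : suc n ≤ q * q
    s≤q² = begin
      suc n                              ≤⟨ s≤s (n≤1+2⌊n/2⌋ n) ⟩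
      2 + (⌊ n /2⌋ + ⌊ n /2⌋)            ≡⟨ cong (λ h → 2 + (h + h)) q+k≡ ⟨
      2 + ((q + k) + (q + k))            ≡⟨ regroup q k ⟩
      (2 + (k + k)) * 1 + 2 * q          ≤⟨ +-monoˡ-≤ (2 * q) (*-monoʳ-≤ (2 + (k + k)) (≤-trans (s≤s z≤n) c≤q)) ⟩
      (2 + (k + k)) * q + 2 * q          ≡⟨ collect q k ⟩
      c * q                              ≤⟨ *-monoˡ-≤ q c≤q ⟩
      q * q                              ∎
      where
      regroup : ∀ q k → 2 + ((q + k) + (q + k)) ≡ (2 + (k + k)) * 1 + 2 * q
      regroup = solve-∀
      collect : ∀ q k → (2 + (k + k)) * q + 2 * q ≡ (2 + (k + (k + 2))) * q
      collect = solve-∀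

-- A lower bound for the loss of a chain on which S misses the levels of ranks 0 and 1. Missing rank
-- 0 alone would not do, since ranks 0 and 1 have equal size when n is odd.
gain : ℕ → ℕ
gain n = layer n 0 ∸ layer n 2

gain+layer₂ : ∀ n → gain n + layer n 2 ≡ layer n 0
gain+layer₂ n = m∸n+n≡m (layer-antitone n {0} {2} z≤n)

-- The two layers are neighbouring levels h + 1 and h, with ratio (h + 1) / (j + 1) by `C-absorb`.
-- As h + 1 ≤ j, they differ by at least the fraction 1 / (j + 1) of the larger one.
layer₀≤gain : ∀ n → 2 ≤ n → layer n 0 ≤ suc n * gain n
layer₀≤gain (suc zero) (s≤s ())
layer₀≤gain (suc (suc m)) _ with m≤n⇒∃[o]m+o≡n (⌊n/2⌋≤⌈n/2⌉ m)
... | d , h+d≡ = +-cancelˡ-≤ (j * c₁) _ _ (begin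
  j * c₁ + c₁                  ≡⟨ +-comm (j * c₁) c₁ ⟩
  suc j * c₁                   ≡⟨ cong (suc j *_) (gain+layer₂ n) ⟨
  suc j * (g + c₀)             ≡⟨ *-distribˡ-+ (suc j) g c₀ ⟩
  suc j * g + suc j * c₀       ≡⟨ cong (suc j * g +_) absorb ⟨
  suc j * g + suc h * c₁       ≤⟨ +-mono-≤ (*-monoˡ-≤ g (s≤s j≤n)) (*-monoˡ-≤ c₁ (s≤s h≤⌈m/2⌉)) ⟩
  suc n * g + j * c₁           ≡⟨ +-comm (suc n * g) (j * c₁) ⟩
  j * c₁ + suc n * g           ∎)
  where
  open ≤-Reasoning
  n = suc (suc m)
  h = ⌊ m /2⌋
  j = suc ⌈ m /2⌉
  c₁ = layer n 0
  c₀ = layer n 2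
  g = gain n
  h≤⌈m/2⌉ = ⌊n/2⌋≤⌈n/2⌉ m
  n≡ : n ≡ h + suc j
  n≡ = sym (trans (+-suc h j) (cong suc (trans (+-suc h _) (cong suc (⌊n/2⌋+⌈n/2⌉≡n m)))))
  j≤n : j ≤ n
  j≤n = m≤n⇒m≤1+n (s≤s (⌈n/2⌉≤n m))
  absorb : suc h * c₁ ≡ suc j * c₀
  absorb = subst (λ n → suc h * (n C suc h) ≡ suc j * (n C h)) (sym n≡) (C-absorb h j)

-- Rank 0 or 1 means that 2b lies between n - 1 and n + 2. The second bound is weaker by one because
-- for even n the level n/2 + 1 has rank 1.
central-level : ∀ {n b e} → rank n b < 2 → b + e ≡ n → ⌊ n /2⌋ ≤ b × ⌊ n /2⌋ ≤ suc e
central-level {_} {b} {e} r<2 refl with rank-view (b + e) b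
... | inj₁ p = n/2≤b , ≤-trans n/2≤b (m≤n⇒m≤1+n (+-cancelˡ-≤ b b e (m+n≤o⇒m≤o (b + b) (≤-reflexive p))))
  where
  open ≤-Reasoning
  n/2≤b : ⌊ b + e /2⌋ ≤ b
  n/2≤b = begin
    ⌊ b + e /2⌋                          ≡⟨ cong ⌊_/2⌋ p ⟨
    ⌊ b + b + rank (b + e) b /2⌋         ≤⟨ ⌊n/2⌋-mono (+-monoʳ-≤ (b + b) (s≤s⁻¹ r<2)) ⟩
    ⌊ b + b + 1 /2⌋                      ≡⟨ cong ⌊_/2⌋ (+-comm (b + b) 1) ⟩
    ⌈ b + b /2⌉                          ≡⟨ n≡⌈n+n/2⌉ b ⟨
    b                                    ∎
... | inj₂ p = n/2≤b , n/2≤1+e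
  where
  open ≤-Reasoning
  r = rank (b + e) b
  n/2≤b : ⌊ b + e /2⌋ ≤ b
  n/2≤b = subst (⌊ b + e /2⌋ ≤_) (sym (n≡⌊n+n/2⌋ b))
    (⌊n/2⌋-mono (≤-trans (n≤1+n (b + e)) (m+n≤o⇒m≤o (suc (b + e)) (≤-reflexive p))))
  b≤ : b ≤ suc (suc e)
  b≤ = +-cancelˡ-≤ b _ _ (begin
    b + b                  ≡⟨ p ⟨
    suc (b + e) + r        ≤⟨ +-monoʳ-≤ (suc (b + e)) (s≤s⁻¹ r<2) ⟩
    suc (b + e) + 1        ≡⟨ regroup b e ⟩
    b + suc (suc e)        ∎)
    where
    regroup : ∀ b e → suc (b + e) + 1 ≡ b + suc (suc e)
    regroup = solve-∀
  n/2≤1+e : ⌊ b + e /2⌋ ≤ suc e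
  n/2≤1+e = ≤-trans (⌊n/2⌋-mono (+-monoˡ-≤ e b≤)) (≤-reflexive (cong suc (sym (n≡⌊n+n/2⌋ e))))

module Estimates {k n : ℕ} (k≥1 : 1 ≤ k) (large : Large k n) where
  open Large large
  open ≤-Reasoning

  k≤n/2 : k ≤ ⌊ n /2⌋
  k≤n/2 = ≤-trans (m≤n+m k q) q+k≤n/2

  k≤n : k ≤ n
  k≤n = ≤-trans k≤n/2 (⌊n/2⌋≤n n)

  2≤n : 2 ≤ n
  2≤n = begin
    1 + 1                   ≤⟨ +-mono-≤ (≤-trans k≥1 k≤n/2) (≤-trans k≥1 k≤n/2) ⟩
    ⌊ n /2⌋ + ⌊ n /2⌋       ≤⟨ +-monoʳ-≤ ⌊ n /2⌋ (⌊n/2⌋≤⌈n/2⌉ n) ⟩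
    ⌊ n /2⌋ + ⌈ n /2⌉       ≡⟨ ⌊n/2⌋+⌈n/2⌉≡n n ⟩
    n                       ∎

  s K : ℕ
  s = suc n
  K = s ^ k

  s^D≡ : s ^ (3 + (k + k)) ≡ s * (s * (s * (K * K)))
  s^D≡ = cong (λ z → s * (s * (s * z))) (^-distribˡ-+-* s k k)

  2K≤2^q : 2 * K ≤ 2 ^ q
  2K≤2^q = ≤-trans (*-monoʳ-≤ 2 (^-monoʳ-≤ s {k} (≤-trans (m≤m+n k k) (m≤n+m (k + k) 3)))) 2s^D≤2^q

  extra≤K : extra n k ≤ K
  extra≤K = begin
    ⌈ n + k /2⌉ C k     ≤⟨ C-monoˡ k (⌈n/2⌉-mono (+-monoʳ-≤ n k≤n)) ⟩
    ⌈ n + n /2⌉ C k     ≡⟨ cong (_C k) (n≡⌈n+n/2⌉ n) ⟨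
    n C k               ≤⟨ C≤[1+n]^k n k ⟩
    K                   ∎

  C-low≤K : ∀ {a} → a < k → n C a ≤ K
  C-low≤K {a} a<k = ≤-trans (C≤[1+n]^k n a) (^-monoʳ-≤ s (<⇒≤ a<k))

  2s²K²≤gain : 2 * (s * s * K * K) ≤ gain n
  2s²K²≤gain = *-cancelˡ-≤ s (begin
    s * (2 * (s * s * K * K))           ≡⟨ regroup s K ⟩
    2 * (s * (s * (s * (K * K))))       ≡⟨ cong (2 *_) s^D≡ ⟨
    2 * s ^ (3 + (k + k))               ≤⟨ 2s^D≤2^q ⟩
    2 ^ q                               ≤⟨ 2^q≤C q≤n/2 (≤-trans q≤n/2 (⌊n/2⌋≤⌈n/2⌉ n)) ⟩
    (⌊ n /2⌋ + ⌈ n /2⌉) C ⌊ n /2⌋       ≡⟨ cong (_C ⌊ n /2⌋) (⌊n/2⌋+⌈n/2⌉≡n n) ⟩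
    layer n 0                           ≤⟨ layer₀≤gain n 2≤n ⟩
    s * gain n                          ∎)
    where
    q≤n/2 : q ≤ ⌊ n /2⌋
    q≤n/2 = ≤-trans (m≤m+n q k) q+k≤n/2
    regroup : ∀ s K → s * (2 * (s * s * K * K)) ≡ 2 * (s * (s * (s * (K * K))))
    regroup = solve-∀

  -- The a! e! chains through a low set are at least `n !` / `K`, so their gain exceeds twice a
  -- polynomial cost on every chain.
  low-cost≤gain : ∀ {a e} → a < k → a + e ≡ n → 2 * (n ! * (s * s * K)) ≤ gain n * (a ! * e !)
  low-cost≤gain {a} {e} a<k refl = begin
    2 * (n ! * (s * s * K))                       ≡⟨ cong (λ z → 2 * (z * (s * s * K))) (C-factorial a e) ⟨
    2 * ((n C a) * (a ! * e !) * (s * s * K))     ≤⟨ *-monoʳ-≤ 2 (*-monoˡ-≤ (s * s * K) (*-monoˡ-≤ (a ! * e !) (C-low≤K a<k))) ⟩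
    2 * (K * (a ! * e !) * (s * s * K))           ≡⟨ regroup s K (a ! * e !) ⟩
    2 * (s * s * K * K) * (a ! * e !)             ≤⟨ *-monoˡ-≤ (a ! * e !) 2s²K²≤gain ⟩
    gain n * (a ! * e !)                          ∎
    where
    regroup : ∀ s K x → 2 * (K * x * (s * s * K)) ≡ 2 * (s * s * K * K) * x
    regroup = solve-∀

  low⇒¬central : ∀ {a} → a < k → ¬ rank n a < 2
  low⇒¬central {a} a<k central with m≤n⇒∃[o]m+o≡n (<⇒≤ (<-≤-trans a<k k≤n))
  ... | e , a+e≡n = <⇒≱ a<k (≤-trans k≤n/2 (proj₁ (central-level central a+e≡n)))

  -- Among the chains through A, the share that also passes through B is 1 / C(d + e, d). For a
  -- central B both `d` and `e` are at least `q`, so this share is at most 2^-q.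
  2extra*through≤ : ∀ {A B : Subset n} {d e} → ∣ A ∣ < k → rank n ∣ B ∣ < 2 → A ⊆ B →
                    ∣ A ∣ + d ≡ ∣ B ∣ → ∣ B ∣ + e ≡ n → 2 * extra n k * through A B ≤ ∣ A ∣ ! * (d + e) !
  2extra*through≤ {A} {B} {d} {e} a<k central A⊆B a+d≡b b+e≡n = begin
    2 * extra n k * through A B                   ≡⟨ cong (2 * extra n k *_) (through-⊆ A⊆B a+d≡b b+e≡n) ⟩
    2 * extra n k * (∣ A ∣ ! * d ! * e !)         ≤⟨ *-monoˡ-≤ (∣ A ∣ ! * d ! * e !) (≤-trans (*-monoʳ-≤ 2 extra≤K)
                                                       (≤-trans 2K≤2^q (2^q≤C q≤d q≤e))) ⟩
    ((d + e) C d) * (∣ A ∣ ! * d ! * e !)         ≡⟨ regroup ((d + e) C d) (∣ A ∣ !) (d !) (e !) ⟩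
    ∣ A ∣ ! * (((d + e) C d) * (d ! * e !))       ≡⟨ cong (∣ A ∣ ! *_) (C-factorial d e) ⟩
    ∣ A ∣ ! * (d + e) !                           ∎
    where
    regroup : ∀ c a x y → c * (a * x * y) ≡ a * (c * (x * y))
    regroup = solve-∀
    q≤d : q ≤ d
    q≤d = +-cancelʳ-≤ k q d (begin
      q + k         ≤⟨ q+k≤n/2 ⟩
      ⌊ n /2⌋       ≤⟨ proj₁ (central-level central b+e≡n) ⟩
      ∣ B ∣         ≡⟨ a+d≡b ⟨
      ∣ A ∣ + d     ≤⟨ +-monoˡ-≤ d (<⇒≤ a<k) ⟩
      k + d         ≡⟨ +-comm k d ⟩
      d + k         ∎)
    q≤e : q ≤ e
    q≤e = +-cancelʳ-≤ 1 q e (begin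
      q + 1         ≤⟨ +-monoʳ-≤ q k≥1 ⟩
      q + k         ≤⟨ q+k≤n/2 ⟩
      ⌊ n /2⌋       ≤⟨ proj₂ (central-level central b+e≡n) ⟩
      suc e         ≡⟨ +-comm 1 e ⟩
      e + 1         ∎)

-- Averaging over all maximal chains

on-chain : ∀ {n} → List (Subset n) → Flag n → List (Subset n)
on-chain S F = filter (on? F) S

-- Keeps only the pairs to which `extra*min≤` applies; nothing is required of the distance of the
-- upper level from n.
goodWeight : ℕ → ℕ → ℕ → ℕ → ℕ
goodWeight n k a b = 𝟙 (k ≤? a ⊓ b) * weight n k a b

onLevels : ∀ {n} → (ℕ → ℕ → ℕ) → Subset n → Subset n → ℕ
onLevels f A B = f (∣ A ∣) (∣ B ∣)

onWeight : ∀ {n} → (ℕ → ℕ → ℕ) → Subset n → Subset n → ℕ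
onWeight f A B = through A B * onLevels f A B

comp≡∑₂ : ∀ {n} (S : List (Subset n)) → comp S ≡ ∑₂ S (λ A B → 𝟙 (comparable? (A , B)))
comp≡∑₂ S = length-filter≡∑ comparable? (pairs S)

unique-levels : ∀ {n} (F : Flag n) X → All (On F) X → Unique X → Unique (map ∣_∣ X)
unique-levels F []      _         _        = []
unique-levels F (A ∷ X) (FA ∷ FX) (A# ∷ u) = All.map⁺ (go FX A#) ∷ unique-levels F X FX u
  where
  go : ∀ {Y} → All (On F) Y → All (A ≢_) Y → All (λ B → ∣ A ∣ ≢ ∣ B ∣) Y
  go []        []         = []
  go (FB ∷ FY) (A≢B ∷ A#) = (λ a≡b → A≢B (On-injective F FA FB a≡b)) ∷ go FY A#

module Averaging {n k′ : ℕ} (S : List (Subset n)) (unique : Unique S) where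
  open ≤-Reasoning

  k = suc k′

  chain-bound : ∀ (F : Flag n) m → All (λ A → m ≤ rank n ∣ A ∣) (on-chain S F) →
    ∑ (on-chain S F) (λ A → n C ∣ A ∣) ≤
    ∑ (upTo k) (λ i → layer n (m + i)) + ∑₂ (on-chain S F) (onLevels (weight n k))
  chain-bound F m m≤ = subst₂ _≤_ (∑-map X ∣_∣ (n C_))
    (cong (∑ (upTo k) (λ i → layer n (m + i)) +_) (∑₂-map X ∣_∣ (weight n k)))
    (chain-inequality m (map ∣_∣ X) (unique-levels F X (all-filter (on? F) S) (Unique.filter⁺ (on? F) unique))
      (All.map⁺ (All.universal ∣p∣≤n X)) (All.map⁺ m≤))
    where X = on-chain S F

  length-chain : ∀ (F : Flag n) → length (on-chain S F) ≤ suc n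
  length-chain F = subst (_≤ suc n) (length-map ∣_∣ X) (unique-interval⇒length≤ {m = 0}
    (unique-levels F X (all-filter (on? F) S) (Unique.filter⁺ (on? F) unique))
    (All.universal (λ _ → z≤n) _) (All.map⁺ (All.universal (λ A → s≤s (∣p∣≤n A)) X)))
    where X = on-chain S F

  ∑-chains-C : ∑ (flags n) (λ F → ∑ (on-chain S F) (λ A → n C ∣ A ∣)) ≡ length S * n !
  ∑-chains-C = begin-equality
    ∑ (flags n) (λ F → ∑ (on-chain S F) (λ A → n C ∣ A ∣))       ≡⟨ ∑-cong (flags n) (λ F → ∑-filter (on? F) S _) ⟩
    ∑ (flags n) (λ F → ∑ S (λ A → 𝟙 (on? F A) * (n C ∣ A ∣)))    ≡⟨ ∑-swap (flags n) S _ ⟩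
    ∑ S (λ A → ∑ (flags n) (λ F → 𝟙 (on? F A) * (n C ∣ A ∣)))    ≡⟨ ∑-cong S each ⟩
    ∑ S (λ _ → n !)                                              ≡⟨ ∑-const S (n !) ⟩
    length S * n !                                               ∎
    where
    each : ∀ A → ∑ (flags n) (λ F → 𝟙 (on? F A) * (n C ∣ A ∣)) ≡ n !
    each A with m≤n⇒∃[o]m+o≡n (∣p∣≤n A)
    ... | e , a+e≡n = begin-equality
      ∑ (flags n) (λ F → 𝟙 (on? F A) * (n C ∣ A ∣))     ≡⟨ ∑-*ʳ (flags n) (λ F → 𝟙 (on? F A)) _ ⟩
      ∑ (flags n) (λ F → 𝟙 (on? F A)) * (n C ∣ A ∣)     ≡⟨ cong (_* (n C ∣ A ∣)) (∑-on A a+e≡n) ⟩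
      ∣ A ∣ ! * e ! * (n C ∣ A ∣)                       ≡⟨ *-comm _ (n C ∣ A ∣) ⟩
      (n C ∣ A ∣) * (∣ A ∣ ! * e !)                     ≡⟨ cong (λ n → (n C ∣ A ∣) * (∣ A ∣ ! * e !)) a+e≡n ⟨
      ((∣ A ∣ + e) C ∣ A ∣) * (∣ A ∣ ! * e !)           ≡⟨ C-factorial ∣ A ∣ e ⟩
      (∣ A ∣ + e) !                                     ≡⟨ cong _! a+e≡n ⟩
      n !                                               ∎

  ∑-chains-weight : ∀ f → ∑ (flags n) (λ F → ∑₂ (on-chain S F) (onLevels f)) ≡ ∑₂ S (onWeight f)
  ∑-chains-weight f = begin-equality
    ∑ (flags n) (λ F → ∑₂ (on-chain S F) (onLevels f))
      ≡⟨ ∑-cong (flags n) (λ F → ∑₂-filter (on? F) S _) ⟩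
    ∑ (flags n) (λ F → ∑₂ S (λ A B → (𝟙 (on? F A) * 𝟙 (on? F B)) * onLevels f A B))
      ≡⟨ ∑-swap (flags n) (pairs S) _ ⟩
    ∑₂ S (λ A B → ∑ (flags n) (λ F → (𝟙 (on? F A) * 𝟙 (on? F B)) * onLevels f A B))
      ≡⟨ ∑-cong (pairs S) (λ (A , B) → ∑-*ʳ (flags n) (λ F → 𝟙 (on? F A) * 𝟙 (on? F B)) _) ⟩
    ∑₂ S (onWeight f) ∎

  ∑-flags-const : ∀ c → ∑ (flags n) (λ _ → c) ≡ n ! * c
  ∑-flags-const c = begin-equality
    ∑ (flags n) (λ _ → c)           ≡⟨ ∑-cong (flags n) (λ _ → +-identityʳ c) ⟨
    ∑ (flags n) (λ _ → 1 * c)       ≡⟨ ∑-*ʳ (flags n) (λ _ → 1) c ⟩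
    ∑ (flags n) (λ _ → 1) * c       ≡⟨ cong (_* c) (length-flags n) ⟩
    n ! * c                         ∎

  goodWeight-⊆ : ∀ {A B : Subset n} → A ⊆ B → extra n k * onWeight (goodWeight n k) A B ≤ n !
  goodWeight-⊆ {A} {B} A⊆B with k ≤? ∣ A ∣ ⊓ ∣ B ∣ | k ≤? ∣ ∣ A ∣ - ∣ B ∣ ∣
  ... | no _    | _      = ≤-trans (≤-reflexive (trans (cong (extra n k *_) (*-zeroʳ (through A B))) (*-zeroʳ (extra n k)))) z≤n
  ... | yes _   | no _   = ≤-trans (≤-reflexive (trans (cong (extra n k *_) (*-zeroʳ (through A B))) (*-zeroʳ (extra n k)))) z≤n
  ... | yes k≤⊓ | yes k≤d with m≤n⇒∃[o]m+o≡n (p⊆q⇒∣p∣≤∣q∣ A⊆B) | m≤n⇒∃[o]m+o≡n (∣p∣≤n B)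
  ...   | d , a+d≡b | e , b+e≡n = begin
    extra n k * (through A B * (1 * (1 * min n ∣ B ∣)))
      ≡⟨ cong₂ (λ t m → extra n k * (t * m)) (through-⊆ A⊆B a+d≡b b+e≡n)
           (trans (*-identityˡ _) (*-identityˡ _)) ⟩
    extra n k * (∣ A ∣ ! * d ! * e ! * min n ∣ B ∣)
      ≡⟨ regroup (extra n k) (∣ A ∣ ! * d ! * e !) (min n ∣ B ∣) ⟩
    extra n k * min n ∣ B ∣ * (∣ A ∣ ! * d ! * e !)
      ≡⟨ cong₂ (λ n b → extra n k * min n b * (∣ A ∣ ! * d ! * e !)) n≡ a+d≡b ⟨
    extra (∣ A ∣ + d + e) k * min (∣ A ∣ + d + e) (∣ A ∣ + d) * (∣ A ∣ ! * d ! * e !)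
      ≤⟨ extra*min≤ {k} {∣ A ∣} {d} {e} (m≤n⊓o⇒m≤n ∣ A ∣ ∣ B ∣ k≤⊓) k≤d′ ⟩
    (∣ A ∣ + d + e) !
      ≡⟨ cong _! n≡ ⟩
    n ! ∎
    where
    min : ℕ → ℕ → ℕ
    min n b = (n C ∣ A ∣) ⊓ (n C b)
    n≡ : ∣ A ∣ + d + e ≡ n
    n≡ = trans (cong (_+ e) a+d≡b) b+e≡n
    k≤d′ : k ≤ d
    k≤d′ = subst (k ≤_) (trans (cong (λ b → ∣ ∣ A ∣ - b ∣) (sym a+d≡b)) (∣m-m+n∣≡n ∣ A ∣ d)) k≤d
    regroup : ∀ x y z → x * (y * z) ≡ x * z * y
    regroup = solve-∀

  goodWeight-comparable : ∀ (A B : Subset n) →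
    extra n k * onWeight (goodWeight n k) A B ≤ n ! * 𝟙 (comparable? (A , B))
  goodWeight-comparable A B with comparable? (A , B)
  ... | yes (inj₁ A⊆B) = ≤-trans (goodWeight-⊆ {A} {B} A⊆B) (≤-reflexive (sym (*-identityʳ (n !))))
  ... | yes (inj₂ B⊆A) = ≤-trans (≤-reflexive (cong (extra n k *_) (cong₂ _*_ (through-comm A B)
        (cong₂ _*_ (cong (λ m → 𝟙 (k ≤? m)) (⊓-comm ∣ A ∣ ∣ B ∣)) (weight-comm n k ∣ A ∣ ∣ B ∣)))))
        (≤-trans (goodWeight-⊆ {B} {A} B⊆A) (≤-reflexive (sym (*-identityʳ (n !)))))
  ... | no A≁B         = ≤-reflexive (trans (cong (λ t → extra n k * (t * onLevels (goodWeight n k) A B))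
        (through-incomparable A B A≁B)) (trans (*-zeroʳ (extra n k)) (sym (*-zeroʳ (n !)))))

  -- Both cases, with and without low sets, end here: the excess `n ! * t` is covered by good pairs,
  -- and `extra n k` times the share of a comparable pair is at most `n !`.
  average⇒comp : ∀ {M} t → M + t ≤ length S → length S * n ! ≤ n ! * M + ∑₂ S (onWeight (goodWeight n k)) →
                 t * extra n k ≤ comp S
  average⇒comp {M} t M+t≤ average = *-cancelˡ-≤ (n !) {{n !≢0}} (begin
    n ! * (t * extra n k)                             ≡⟨ regroup (n !) t (extra n k) ⟩
    extra n k * (n ! * t)                             ≤⟨ *-monoʳ-≤ (extra n k) t≤ ⟩
    extra n k * ∑₂ S w                                ≡⟨ ∑-*ˡ (pairs S) (uncurry w) (extra n k) ⟨
    ∑₂ S (λ A B → extra n k * w A B)                  ≤⟨ ∑₂-mono-∈ S (λ {A} {B} _ _ → goodWeight-comparable A B) ⟩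
    ∑₂ S (λ A B → n ! * 𝟙 (comparable? (A , B)))      ≡⟨ ∑-*ˡ (pairs S) (𝟙 ∘ comparable?) (n !) ⟩
    n ! * ∑ (pairs S) (𝟙 ∘ comparable?)               ≡⟨ cong (n ! *_) (comp≡∑₂ S) ⟨
    n ! * comp S                                      ∎)
    where
    w : Subset n → Subset n → ℕ
    w = onWeight (goodWeight n k)
    regroup : ∀ a b c → a * (b * c) ≡ c * (a * b)
    regroup = solve-∀
    t≤ : n ! * t ≤ ∑₂ S w
    t≤ = +-cancelˡ-≤ (n ! * M) _ _ (begin
      n ! * M + n ! * t     ≡⟨ *-distribˡ-+ (n !) M t ⟨
      n ! * (M + t)         ≤⟨ *-monoʳ-≤ (n !) M+t≤ ⟩
      n ! * length S        ≡⟨ *-comm (n !) (length S) ⟩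
      length S * n !        ≤⟨ average ⟩
      n ! * M + ∑₂ S w      ∎)

  no-low-sets : ∀ {t} → ∑ (upTo k) (layer n) + t ≤ length S → All (λ A → k ≤ ∣ A ∣) S → t * extra n k ≤ comp S
  no-low-sets {t} M+t≤ high = average⇒comp t M+t≤ (begin
    length S * n !                                                   ≡⟨ ∑-chains-C ⟨
    ∑ (flags n) (λ F → ∑ (on-chain S F) (λ A → n C ∣ A ∣))           ≤⟨ ∑-mono (flags n) (λ F → chain-bound F 0 (All.universal (λ _ → z≤n) _)) ⟩
    ∑ (flags n) (λ F → M + ∑₂ (on-chain S F) (onLevels (weight n k))) ≡⟨ ∑-+ (flags n) (λ _ → M) _ ⟩
    ∑ (flags n) (λ _ → M) + ∑ (flags n) (λ F → ∑₂ (on-chain S F) (onLevels (weight n k)))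
                                                                     ≡⟨ cong₂ _+_ (∑-flags-const M) (∑-chains-weight (weight n k)) ⟩
    n ! * M + ∑₂ S (onWeight (weight n k))                           ≤⟨ +-monoʳ-≤ (n ! * M) (∑₂-mono-∈ S λ {A} {B} A∈ B∈ →
                                                                          *-monoʳ-≤ (through A B) (good A∈ B∈)) ⟩
    n ! * M + ∑₂ S (onWeight (goodWeight n k))                       ∎)
    where
    M = ∑ (upTo k) (layer n)
    good : ∀ {A B} → A ∈ S → B ∈ S → onLevels (weight n k) A B ≤ onLevels (goodWeight n k) A B
    good {A} {B} A∈ B∈ = ≤-reflexive (sym (trans
      (cong (_* onLevels (weight n k) A B) (𝟙-yes (k ≤? ∣ A ∣ ⊓ ∣ B ∣) (⊓-glb (All.lookup high A∈) (All.lookup high B∈))))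
      (*-identityˡ _)))

  -- The case of a low set of small degree

  module _ (large : Large k n) where
    open Estimates {k} {n} (s≤s z≤n) large

    -- A pair dropped from `goodWeight` has a level below k, and the size of this level alone caps
    -- its weight.
    weight≤ : ∀ a b → weight n k a b ≤ goodWeight n k a b + K
    weight≤ a b with k ≤? a ⊓ b
    ... | yes _   = ≤-trans (≤-reflexive (sym (*-identityˡ _))) (m≤m+n _ K)
    ... | no k≰⊓ = begin
      weight n k a b              ≤⟨ *-monoˡ-≤ ((n C a) ⊓ (n C b)) (𝟙≤1 (k ≤? ∣ a - b ∣)) ⟩
      1 * ((n C a) ⊓ (n C b))     ≡⟨ *-identityˡ _ ⟩
      (n C a) ⊓ (n C b)           ≤⟨ min≤K (⊓-sel a b) ⟩
      K                           ∎
      where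
      min≤K : a ⊓ b ≡ a ⊎ a ⊓ b ≡ b → (n C a) ⊓ (n C b) ≤ K
      min≤K (inj₁ eq) = ≤-trans (m⊓n≤m (n C a) _) (C-low≤K (subst (_< k) eq (≰⇒> k≰⊓)))
      min≤K (inj₂ eq) = ≤-trans (m⊓n≤n (n C a) _) (C-low≤K (subst (_< k) eq (≰⇒> k≰⊓)))

    pair-cost : ∀ (F : Flag n) → ∑₂ (on-chain S F) (onLevels (weight n k)) ≤
                        ∑₂ (on-chain S F) (onLevels (goodWeight n k)) + s * s * K
    pair-cost F = begin
      ∑₂ X (onLevels (weight n k))           ≤⟨ ∑₂-mono-∈ X (λ {A} {B} _ _ → weight≤ ∣ A ∣ ∣ B ∣) ⟩
      ∑₂ X (λ A B → onLevels (goodWeight n k) A B + K)   ≡⟨ ∑-+ (pairs X) _ (λ _ → K) ⟩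
      G + ∑ (pairs X) (λ _ → K)                       ≡⟨ cong (G +_) (∑-const (pairs X) K) ⟩
      G + length (pairs X) * K                        ≤⟨ +-monoʳ-≤ G (*-monoˡ-≤ K (≤-trans (length-pairs X)
                                                          (*-mono-≤ (length-chain F) (length-chain F)))) ⟩
      G + s * s * K                                   ∎
      where
      X = on-chain S F
      G = ∑₂ X (onLevels (goodWeight n k))

    M = ∑ (upTo k) (layer n)

    -- The gain lifts the term of rank 2 to that of rank 0; the others, of ranks 3 + i, are at most
    -- those of ranks 1 + i.
    gain+outer≤ : gain n + ∑ (upTo k) (λ i → layer n (2 + i)) ≤ M
    gain+outer≤ = begin
      gain n + ∑ (upTo k) (λ i → layer n (2 + i))                       ≡⟨ cong (gain n +_) (∑-upTo-suc k′ (λ i → layer n (2 + i))) ⟩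
      gain n + (layer n 2 + ∑ (upTo k′) (λ i → layer n (3 + i)))        ≡⟨ +-assoc (gain n) _ _ ⟨
      gain n + layer n 2 + ∑ (upTo k′) (λ i → layer n (3 + i))          ≤⟨ +-mono-≤ (≤-reflexive (gain+layer₂ n))
                                                                            (∑-mono (upTo k′) λ i → layer-antitone n (m≤n+m (suc i) 2)) ⟩
      layer n 0 + ∑ (upTo k′) (layer n ∘ suc)                           ≡⟨ ∑-upTo-suc k′ (layer n) ⟨
      M                                                                 ∎

    hit : Subset n → Flag n → Subset n → ℕ
    hit A F B = 𝟙 (rank n ∣ B ∣ <? 2) * (𝟙 (on? F A) * 𝟙 (on? F B))

    -- Every chain through A is credited the gain, and pays it back if it meets S in a central
    -- level. Meeting both central levels repays it twice, which only weakens the bound.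
    chain-bound-gain : ∀ A (F : Flag n) →
      ∑ (on-chain S F) (λ A → n C ∣ A ∣) + gain n * 𝟙 (on? F A) ≤
      M + ∑₂ (on-chain S F) (onLevels (weight n k)) + gain n * ∑ S (hit A F)
    chain-bound-gain A F with on? F A
    ... | no _  = +-mono-≤ (chain-bound F 0 (All.universal (λ _ → z≤n) _)) (*-monoʳ-≤ (gain n) {0} z≤n)
    ... | yes _ with Any.any? (λ B → rank n ∣ B ∣ <? 2) (on-chain S F)
    ...   | yes some = +-mono-≤ (chain-bound F 0 (All.universal (λ _ → z≤n) _)) (*-monoʳ-≤ (gain n) hits≥1)
      where
      hits≥1 : 1 ≤ ∑ S (λ B → 𝟙 (rank n ∣ B ∣ <? 2) * (1 * 𝟙 (on? F B)))
      hits≥1 = begin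
        1                                                           ≤⟨ ≤∑-Any (Any.map (λ {B} c → ≤-reflexive (sym (𝟙-yes (rank n ∣ B ∣ <? 2) c))) some) ⟩
        ∑ (on-chain S F) (λ B → 𝟙 (rank n ∣ B ∣ <? 2))              ≡⟨ ∑-filter (on? F) S _ ⟩
        ∑ S (λ B → 𝟙 (on? F B) * 𝟙 (rank n ∣ B ∣ <? 2))             ≡⟨ ∑-cong S (λ B → trans (*-comm (𝟙 (on? F B)) _)
                                                                        (cong (𝟙 (rank n ∣ B ∣ <? 2) *_) (sym (*-identityˡ (𝟙 (on? F B)))))) ⟩
        ∑ S (λ B → 𝟙 (rank n ∣ B ∣ <? 2) * (1 * 𝟙 (on? F B)))       ∎
    ...   | no none = begin
      ∑ X (λ A → n C ∣ A ∣) + gain n * 1          ≤⟨ +-mono-≤ (chain-bound F 2 (All.map ≮⇒≥ (All.¬Any⇒All¬ X none)))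
                                                       (≤-reflexive (*-identityʳ (gain n))) ⟩
      outer + W + gain n                          ≡⟨ regroup outer W (gain n) ⟩
      gain n + outer + W                          ≤⟨ +-monoˡ-≤ W gain+outer≤ ⟩
      M + W                                       ≤⟨ m≤m+n (M + W) _ ⟩
      M + W + gain n * _                          ∎
      where
      X = on-chain S F
      W = ∑₂ X (onLevels (weight n k))
      outer = ∑ (upTo k) (λ i → layer n (2 + i))
      regroup : ∀ a b c → a + b + c ≡ c + a + b
      regroup = solve-∀

    hits : Subset n → ℕ
    hits A = ∑ S (λ B → 𝟙 (rank n ∣ B ∣ <? 2) * through A B)

    ∑-hit : ∀ A → ∑ (flags n) (λ F → ∑ S (hit A F)) ≡ hits A
    ∑-hit A = trans (∑-swap (flags n) S (hit A)) (∑-cong S λ B → ∑-*ˡ (flags n) _ (𝟙 (rank n ∣ B ∣ <? 2)))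

    average-gain : ∀ A {e} → ∣ A ∣ + e ≡ n →
      length S * n ! + gain n * (∣ A ∣ ! * e !) ≤
      n ! * M + ∑₂ S (onWeight (goodWeight n k)) + n ! * (s * s * K) + gain n * hits A
    average-gain A {e} a+e≡n = begin
      length S * n ! + gain n * (∣ A ∣ ! * e !)
        ≡⟨ cong₂ _+_ ∑-chains-C (trans (∑-*ˡ (flags n) (λ F → 𝟙 (on? F A)) (gain n)) (cong (gain n *_) (∑-on A a+e≡n))) ⟨
      ∑ (flags n) (λ F → ∑ (on-chain S F) (λ A → n C ∣ A ∣)) + ∑ (flags n) (λ F → gain n * 𝟙 (on? F A))
        ≡⟨ ∑-+ (flags n) _ _ ⟨
      ∑ (flags n) (λ F → ∑ (on-chain S F) (λ A → n C ∣ A ∣) + gain n * 𝟙 (on? F A))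
        ≤⟨ ∑-mono (flags n) (λ F → ≤-trans (chain-bound-gain A F) (+-monoˡ-≤ (gain n * ∑ S (hit A F)) (+-monoʳ-≤ M (pair-cost F)))) ⟩
      ∑ (flags n) (λ F → M + (G F + s * s * K) + gain n * ∑ S (hit A F))
        ≡⟨ trans (∑-+ (flags n) _ _) (cong₂ _+_ (trans (∑-+ (flags n) (λ _ → M) _) (cong₂ _+_ (∑-flags-const M)
             (trans (∑-+ (flags n) G _) (cong₂ _+_ (∑-chains-weight (goodWeight n k)) (∑-flags-const (s * s * K))))))
             (trans (∑-*ˡ (flags n) _ (gain n)) (cong (gain n *_) (∑-hit A)))) ⟩
      n ! * M + (∑₂ S (onWeight (goodWeight n k)) + n ! * (s * s * K)) + gain n * hits A
        ≡⟨ cong (_+ gain n * hits A) (+-assoc (n ! * M) _ _) ⟨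
      n ! * M + ∑₂ S (onWeight (goodWeight n k)) + n ! * (s * s * K) + gain n * hits A ∎
      where
      G : Flag n → ℕ
      G F = ∑₂ (on-chain S F) (onLevels (goodWeight n k))

    -- Each central B comparable to A lies on at most 1 / (2 `extra n k`) of the chains through A,
    -- and there are fewer than `extra n k` such B. Hence at least half of these chains meet no
    -- central member of S. A itself is low and gives no hit.
    2hits≤ : ∀ {A S′ e} → S ↭ A ∷ S′ → ∣ A ∣ < k → ∣ A ∣ + e ≡ n →
             ∑ S′ (λ B → 𝟙 (comparable? (A , B))) < extra n k → 2 * hits A ≤ ∣ A ∣ ! * e !
    2hits≤ {A} {S′} {e} p a<k a+e≡n deg< = *-cancelˡ-≤ (extra n k) {{>-nonZero (≤-<-trans z≤n deg<)}} (begin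
      extra n k * (2 * hits A)                        ≡⟨ regroup (extra n k) 2 (hits A) ⟩
      2 * extra n k * hits A                          ≡⟨ cong (2 * extra n k *_) hits≡ ⟩
      2 * extra n k * ∑ S′ h                          ≡⟨ ∑-*ˡ S′ h (2 * extra n k) ⟨
      ∑ S′ (λ B → 2 * extra n k * h B)                ≤⟨ ∑-mono S′ each ⟩
      ∑ S′ (λ B → 𝟙 (comparable? (A , B)) * α)        ≡⟨ ∑-*ʳ S′ (λ B → 𝟙 (comparable? (A , B))) α ⟩
      ∑ S′ (λ B → 𝟙 (comparable? (A , B))) * α        ≤⟨ *-monoˡ-≤ α (<⇒≤ deg<) ⟩
      extra n k * α                                   ∎)
      where
      α = ∣ A ∣ ! * e !
      h : Subset n → ℕ
      h B = 𝟙 (rank n ∣ B ∣ <? 2) * through A B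
      regroup : ∀ x y z → x * (y * z) ≡ y * x * z
      regroup = solve-∀
      hits≡ : hits A ≡ ∑ S′ h
      hits≡ = trans (∑-↭ h p) (cong (λ z → z * through A A + ∑ S′ h) (𝟙-no (rank n ∣ A ∣ <? 2) (low⇒¬central a<k)))
      each : ∀ B → 2 * extra n k * h B ≤ 𝟙 (comparable? (A , B)) * α
      each B with rank n ∣ B ∣ <? 2
      ... | no _ = subst (_≤ 𝟙 (comparable? (A , B)) * α) (sym (*-zeroʳ (2 * extra n k))) z≤n
      ... | yes central with comparable? (A , B)
      ...   | no A≁B = ≤-reflexive (trans (cong (λ t → 2 * extra n k * (1 * t)) (through-incomparable A B A≁B))
                                          (*-zeroʳ (2 * extra n k)))
      ...   | yes (inj₂ B⊆A) = contradiction central (low⇒¬central (≤-<-trans (p⊆q⇒∣p∣≤∣q∣ B⊆A) a<k))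
      ...   | yes (inj₁ A⊆B) with m≤n⇒∃[o]m+o≡n (p⊆q⇒∣p∣≤∣q∣ A⊆B) | m≤n⇒∃[o]m+o≡n (∣p∣≤n B)
      ...     | d , a+d≡b | e′ , b+e′≡n = begin
        2 * extra n k * (1 * through A B)     ≡⟨ cong (2 * extra n k *_) (*-identityˡ (through A B)) ⟩
        2 * extra n k * through A B           ≤⟨ 2extra*through≤ {A} {B} a<k central A⊆B a+d≡b b+e′≡n ⟩
        ∣ A ∣ ! * (d + e′) !                  ≡⟨ cong (λ m → ∣ A ∣ ! * m !) d+e′≡e ⟩
        α                                     ≡⟨ *-identityˡ α ⟨
        1 * α                                 ∎
        where
        d+e′≡e : d + e′ ≡ e
        d+e′≡e = +-cancelˡ-≡ ∣ A ∣ _ _ (trans (sym (+-assoc ∣ A ∣ d e′))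
                   (trans (cong (_+ e′) a+d≡b) (trans b+e′≡n (sym a+e≡n))))

    -- After doubling, one copy of the gain pays for the exceptional pairs and the other for the
    -- hits. Both cancel, and the average without low-set terms remains.
    low-degree : ∀ {t A S′} → M + t ≤ length S → S ↭ A ∷ S′ → ∣ A ∣ < k →
                 ∑ S′ (λ B → 𝟙 (comparable? (A , B))) < extra n k → t * extra n k ≤ comp S
    low-degree {t} {A} M+t≤ p a<k deg< with m≤n⇒∃[o]m+o≡n (∣p∣≤n A)
    ... | e , a+e≡n = average⇒comp t M+t≤ (*-cancelˡ-≤ 2 (+-cancelʳ-≤ (g * α + g * α) _ _ (begin
      2 * L + (g * α + g * α)                   ≡⟨ double L (g * α) ⟩
      2 * (L + g * α)                           ≤⟨ *-monoʳ-≤ 2 (average-gain A a+e≡n) ⟩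
      2 * (R + c + g * hits A)                  ≡⟨ expand R c g (hits A) ⟩
      2 * R + (2 * c + g * (2 * hits A))        ≤⟨ +-monoʳ-≤ (2 * R) (+-mono-≤ (low-cost≤gain a<k a+e≡n)
                                                    (*-monoʳ-≤ g (2hits≤ p a<k a+e≡n deg<))) ⟩
      2 * R + (g * α + g * α)                   ∎)))
      where
      L = length S * n !
      R = n ! * M + ∑₂ S (onWeight (goodWeight n k))
      c = n ! * (s * s * K)
      g = gain n
      α = ∣ A ∣ ! * e !
      double : ∀ x y → 2 * x + (y + y) ≡ 2 * (x + y)
      double = solve-∀
      expand : ∀ r c g h → 2 * (r + c + g * h) ≡ 2 * r + (2 * c + g * (2 * h))
      expand = solve-∀

comp-↭-∷ : ∀ {n} {S S′ : List (Subset n)} {A} → S ↭ A ∷ S′ →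
           comp S ≡ ∑ S′ (λ B → 𝟙 (comparable? (A , B))) + comp S′
comp-↭-∷ {n} {S} {S′} {A} p = begin
  comp S                                                    ≡⟨ comp≡∑₂ S ⟩
  ∑₂ S c                                                    ≡⟨ ∑₂-↭ c c-comm p ⟩
  ∑₂ (A ∷ S′) c                                             ≡⟨ ∑₂-∷ A S′ c ⟩
  ∑ S′ (c A) + ∑₂ S′ c                                      ≡⟨ cong (∑ S′ (c A) +_) (comp≡∑₂ S′) ⟨
  ∑ S′ (c A) + comp S′                                      ∎
  where
  open ≡-Reasoning
  c : Subset n → Subset n → ℕ
  c A B = 𝟙 (comparable? (A , B))
  c-comm : ∀ A B → c A B ≡ c B A
  c-comm A B = 𝟙-⇔ (comparable? (A , B)) (comparable? (B , A)) Sum.swap Sum.swap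

-- Deleting a low set of large degree costs 1 in t and at least extra n k
-- comparable pairs.
comp≥t*extra : ∀ {n k′} → Large (suc k′) n → ∀ t (S : List (Subset n)) → Unique S →
               ∑ (upTo (suc k′)) (layer n) + t ≤ length S → t * extra n (suc k′) ≤ comp S
comp≥t*extra large zero    S unique M+t≤ = z≤n
comp≥t*extra {n} {k′} large (suc t) S unique M+t≤ with Any.any? (λ A → ∣ A ∣ <? suc k′) S
... | no ¬low = Averaging.no-low-sets S unique M+t≤ (All.map ≮⇒≥ (All.¬Any⇒All¬ S ¬low))
... | yes low with find low
...   | A , A∈S , a<k with ∈-∃++ A∈S
...     | xs , ys , refl = by-degree (shift A xs ys)
  where
  open ≤-Reasoning
  by-degree : S ↭ A ∷ (xs ++ ys) → suc t * extra n (suc k′) ≤ comp S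
  by-degree p with extra n (suc k′) ≤? ∑ (xs ++ ys) (λ B → 𝟙 (comparable? (A , B)))
  ... | no deg< = Averaging.low-degree S unique large M+t≤ p a<k (≰⇒> deg<)
  ... | yes deg≥ = begin
    extra n (suc k′) + t * extra n (suc k′)                               ≤⟨ +-mono-≤ deg≥ (comp≥t*extra large t (xs ++ ys)
                                                                               (AllPairs.tail (PermSetoid.Unique-resp-↭ (setoid _) (Perm.↭⇒↭ₛ p) unique))
                                                                               (s≤s⁻¹ (subst₂ _≤_ (+-suc _ t) (↭-length p) M+t≤))) ⟩
    ∑ (xs ++ ys) (λ B → 𝟙 (comparable? (A , B))) + comp (xs ++ ys)        ≡⟨ comp-↭-∷ p ⟨
    comp S                                                                ∎

-- From natural to integer t

open import Data.Integer using (+_)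

mainTheorem8 : (k : ℕ) → .{{NonZero k}} →
    ∃[ n₀ ] ((n : ℕ) → n ≥ n₀ → (t : ℤ) (S : List (Subset n)) → Unique S →
    + length S ℤ.≥ + middleLayers n k ℤ.+ t →
    + comp S ℤ.≥ t ℤ.* + (⌈ n ℕ.+ k /2⌉ C k))
mainTheorem8 k@(suc k′) = proj₁ (eventually-large k) , bound
  where
  bound : (n : ℕ) → n ≥ proj₁ (eventually-large k) → (t : ℤ) (S : List (Subset n)) → Unique S →
    + length S ℤ.≥ + middleLayers n k ℤ.+ t →
    + comp S ℤ.≥ t ℤ.* + (⌈ n ℕ.+ k /2⌉ C k)
  -- For negative t the claimed lower bound is at most 0.
  bound n n≥ (ℤ.-[1+ m ]) S _ _ =
    ℤ.≤-trans (ℤ.*-monoʳ-≤-nonNeg (+ extra n k) {ℤ.-[1+ m ]} {+ 0} ℤ.-≤+) (ℤ.+≤+ z≤n)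
  bound n n≥ (+ t) S unique |S|≥ = subst (ℤ._≤ + comp S) (ℤ.pos-* t (extra n k))
    (ℤ.+≤+ (comp≥t*extra large t S unique
      (subst (λ M → M + t ≤ length S) (middleLayers≡∑layer (Estimates.k≤n (s≤s z≤n) large)) (ℤ.drop‿+≤+ |S|≥))))
    where
    large : Large k n
    large = proj₂ (eventually-large k) n n≥
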